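{- Let $G$ be a finite, simple, connected graph of order $n(G)$ with minimum degree at least $2$ such that $G$ is not isomorphic to the cycle $C_5$. Then $\gamma_{r2}(G)+\gamma_R(G)\leq \frac{4}{3}n(G)$.
   Context: A $2$-rainbow dominating function of a graph $G$ is a function $f:V(G)\to 2^{\{1,2\}}$ such that $\bigcup_{v\in N_G(u)}f(v)=\{1,2\}$ for every vertex $u$ with $f(u)=\emptyset$; its weight is $\sum_{u\in V(G)}|f(u)|$, and $\gamma_{r2}(G)$ is the minimum weight of such a function. A Roman dominating function of $G$ is a function $g:V(G)\to\{0,1,2\}$ such that every vertex $u$ with $g(u)=0$ has a neighbor $v$ with $g(v)=2$; its weight is $\sum_{u\in V(G)}g(u)$, and $\gamma_R(G)$ is the minimum weight of such a function. -}

module Defs where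

open import Data.Nat using (ℕ; zero; suc; _+_; _*_; _≤_)
open import Data.Bool using (Bool; true; false; if_then_else_)
open import Data.Fin using (Fin; toℕ)
open import Data.List using (List; map; allFin)
open import Data.Nat.ListAction using (sum)
open import Data.Product using (Σ; _×_; ∃; ∃-syntax; _,_; proj₁; proj₂)
open import Relation.Binary.PropositionalEquality using (_≡_)
open import Function.Bundles using (_⤖_; Bijection)

record Graph (n : ℕ) : Set where
  field
    adj    : Fin n → Fin n → Bool
    sym    : ∀ u v → adj u v ≡ adj v u
    irrefl : ∀ v → adj v v ≡ false
open Graph public

Adj : ∀ {n} → Graph n → Fin n → Fin n → Set
Adj G u v = adj G u v ≡ true

Σᵥ : ∀ {n} → (Fin n → ℕ) → ℕ
Σᵥ {n} h = sum (map h (allFin n))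

b2n : Bool → ℕ
b2n true  = 1
b2n false = 0

degree : ∀ {n} → Graph n → Fin n → ℕ
degree G u = Σᵥ (λ v → b2n (adj G u v))

MinDegreeAtLeast : ∀ {n} → Graph n → ℕ → Set
MinDegreeAtLeast G k = ∀ u → k ≤ degree G u

data Reach {n} (G : Graph n) : Fin n → Fin n → Set where
  here : ∀ {u} → Reach G u u
  step : ∀ {u v w} → Adj G u v → Reach G v w → Reach G u w

Connected : ∀ {n} → Graph n → Set
Connected G = ∀ u v → Reach G u v

Isomorphic : ∀ {n m} → Graph n → Graph m → Set
Isomorphic {n} {m} G H =
  Σ (Fin n ⤖ Fin m) λ φ →
    ∀ u v → adj H (Bijection.to φ u) (Bijection.to φ v) ≡ adj G u v

c5adj : Fin 5 → Fin 5 → Bool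
c5adj i j = c (toℕ i) (toℕ j)
  where
  c : ℕ → ℕ → Bool
  c 0 1 = true
  c 1 2 = true
  c 2 3 = true
  c 3 4 = true
  c 4 0 = true
  c 1 0 = true
  c 2 1 = true
  c 3 2 = true
  c 4 3 = true
  c 0 4 = true
  c _ _ = false

C5 : Graph 5
C5 = record { adj = c5adj ; sym = s ; irrefl = r }
  where
  open import Data.Fin using (zero; suc)
  open import Relation.Binary.PropositionalEquality using (refl)
  s : ∀ u v → c5adj u v ≡ c5adj v u
  s zero zero = refl
  s zero (suc zero) = refl
  s zero (suc (suc zero)) = refl
  s zero (suc (suc (suc zero))) = refl
  s zero (suc (suc (suc (suc zero)))) = refl
  s (suc zero) zero = refl
  s (suc zero) (suc zero) = refl
  s (suc zero) (suc (suc zero)) = refl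
  s (suc zero) (suc (suc (suc zero))) = refl
  s (suc zero) (suc (suc (suc (suc zero)))) = refl
  s (suc (suc zero)) zero = refl
  s (suc (suc zero)) (suc zero) = refl
  s (suc (suc zero)) (suc (suc zero)) = refl
  s (suc (suc zero)) (suc (suc (suc zero))) = refl
  s (suc (suc zero)) (suc (suc (suc (suc zero)))) = refl
  s (suc (suc (suc zero))) zero = refl
  s (suc (suc (suc zero))) (suc zero) = refl
  s (suc (suc (suc zero))) (suc (suc zero)) = refl
  s (suc (suc (suc zero))) (suc (suc (suc zero))) = refl
  s (suc (suc (suc zero))) (suc (suc (suc (suc zero)))) = refl
  s (suc (suc (suc (suc zero)))) zero = refl
  s (suc (suc (suc (suc zero)))) (suc zero) = refl
  s (suc (suc (suc (suc zero)))) (suc (suc zero)) = refl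
  s (suc (suc (suc (suc zero)))) (suc (suc (suc zero))) = refl
  s (suc (suc (suc (suc zero)))) (suc (suc (suc (suc zero)))) = refl
  r : ∀ v → c5adj v v ≡ false
  r zero = refl
  r (suc zero) = refl
  r (suc (suc zero)) = refl
  r (suc (suc (suc zero))) = refl
  r (suc (suc (suc (suc zero)))) = refl

-- 2-rainbow dominating function: f u ⊆ {1,2} encoded as (1 ∈ f u , 2 ∈ f u)
Label2 : Set
Label2 = Bool × Bool

IsEmptyLabel : Label2 → Set
IsEmptyLabel (a , b) = (a ≡ false) × (b ≡ false)

Is2RDF : ∀ {n} → Graph n → (Fin n → Label2) → Set
Is2RDF G f = ∀ u → IsEmptyLabel (f u) →
  (∃[ v ] (Adj G u v × proj₁ (f v) ≡ true)) ×
  (∃[ v ] (Adj G u v × proj₂ (f v) ≡ true))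

weight2 : ∀ {n} → (Fin n → Label2) → ℕ
weight2 f = Σᵥ (λ u → b2n (proj₁ (f u)) + b2n (proj₂ (f u)))

IsGammaR2 : ∀ {n} → Graph n → ℕ → Set
IsGammaR2 G k = (∃[ f ] (Is2RDF G f × weight2 f ≡ k)) ×
                (∀ f → Is2RDF G f → k ≤ weight2 f)

IsRDF : ∀ {n} → Graph n → (Fin n → Fin 3) → Set
IsRDF G g = ∀ u → toℕ (g u) ≡ 0 → ∃[ v ] (Adj G u v × toℕ (g v) ≡ 2)

weightR : ∀ {n} → (Fin n → Fin 3) → ℕ
weightR g = Σᵥ (λ u → toℕ (g u))

IsGammaR : ∀ {n} → Graph n → ℕ → Set
IsGammaR G k = (∃[ g ] (IsRDF G g × weightR g ≡ k)) ×
               (∀ g → IsRDF G g → k ≤ weightR g)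

{-# OPTIONS --safe #-}
module Submission where

-- Start from the multigraph G itself and repeatedly suppress vertices of degree 2
-- (its edges become chains) and delete direct edges between branch vertices.
-- Cycles that split off are labelled optimally; only C₅ is too expensive, and
-- it is avoided, except that some C₅ remain hanging at a foot by one edge.
-- In the multigraph that remains every vertex has degree at least 3 and no edge is
-- direct.  Label its vertices {1,2} and 2 and the chains as cheaply as possible: a
-- chain then leaves a surplus over 4/3 per vertex, which pays the deficit 8/3 of
-- each branch vertex unless all its chains are (nearly) as bad as a single
-- subdivision vertex.  These poor vertices are relieved in two independent ways:
-- in the rainbow function they receive just one colour, chosen by a locally
-- optimal bipartition, which saves 1/2 each on average; in the Roman function the
-- label 2 is withdrawn from a maximal independent set of those still in need,
-- which saves at least 1/4 each on average.

open import Defs hiding (sym)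
open import Data.Bool using (Bool; true; false; not; _∧_; _∨_; _xor_; if_then_else_)
import Data.Bool as Bool using (T)
import Data.Bool.Properties as Bool
open import Data.Empty using (⊥; ⊥-elim)
open import Data.Fin using (Fin; zero; suc; _≟_; _<?_; toℕ; finToFun; funToFin)
open import Data.Fin.Patterns using (0F; 1F; 2F; 3F; 4F)
open import Data.Fin.Properties using (all?; ¬∀⟶∃¬; finToFun-funToFin)
import Data.Fin.Properties as Fin
open import Data.List using (List; []; _∷_; _++_; map; length; concatMap; zip; reverse; allFin; lookup)
open import Data.List.Membership.Propositional using (_∈_; find; lose)
open import Data.List.Membership.Propositional.Properties
  using (∈-++⁺ˡ; ∈-++⁺ʳ; ∈-++⁻; ∈-map⁺; ∈-map⁻; ∈-∃++; ∈-allFin; ∈-concatMap⁻; ∈-lookup)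
open import Data.List.Properties
  using (map-++; map-∘; length-++; length-reverse; length-tabulate; unfold-reverse; reverse-involutive)
open import Data.List.Relation.Binary.Permutation.Propositional
  using (_↭_; prep; swap; refl; ↭-refl; ↭-reflexive; ↭-trans; ↭-sym; ↭⇒↭ₛ)
open import Data.List.Relation.Binary.Permutation.Propositional.Properties
  using (map⁺; shift; shifts; ∈-resp-↭; ↭-length; ↭-reverse; ++⁺; ++⁺ˡ; ++⁺ʳ; ++-comm; ++-assoc; ++-identityʳ)
import Data.List.Relation.Binary.Permutation.Setoid.Properties as Permₛ
open import Data.List.Relation.Binary.Subset.Propositional using (_⊆_)
open import Data.List.Relation.Unary.All as All using (All; []; _∷_)
open import Data.List.Relation.Unary.AllPairs using ([]; _∷_)
open import Data.List.Relation.Unary.Any using (here; there; any?)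
open import Data.List.Relation.Unary.Unique.Propositional using (Unique)
open import Data.List.Relation.Unary.Unique.Propositional.Properties using (allFin⁺)
open import Data.Nat using (ℕ; zero; suc; _+_; _*_; _^_; _≤_; _<_; z≤n; s≤s; _≤?_)
  renaming (_≟_ to _≟ℕ_; _<?_ to _<?ℕ_)
open import Data.Nat.Induction using (<-wellFounded)
open import Data.Nat.ListAction using (sum)
open import Data.Nat.ListAction.Properties using (sum-++; sum-↭)
open import Data.Nat.Properties hiding (_≟_; _<?_)
open import Data.Nat.Tactic.RingSolver using (solve-∀)
open import Data.Product using (Σ; ∃; _×_; _,_; proj₁; proj₂)
open import Data.Sum using (_⊎_; inj₁; inj₂; [_,_]′)
open import Data.Unit using (⊤; tt)
open import Function using (_∘_)
open import Function.Bundles using (mk⤖)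
open import Induction.WellFounded using (Acc; acc)
open import Relation.Binary.Definitions using (tri<; tri≈; tri>)
open import Relation.Binary.PropositionalEquality hiding ([_])
open import Relation.Nullary using (¬_; Dec; yes; no; does)
open import Relation.Nullary.Decidable using (_×-dec_; _⊎-dec_; _→-dec_; ¬?; dec-true; dec-false; from-yes)

-- Accounts are kept in thirds of a unit of weight, so each vertex is worth 4. Labels `{1,2}` and 2
-- on a branch vertex cost 12, hence its need of 8. A chain end pays 2, 4 or 3 when the number of
-- inner vertices is 1, 2 or 0 modulo 3, so only incomes 6 and 7 fall short. Withdrawing one colour
-- saves 3, but a chain that does not suit the colours of its ends then costs 3 more, half of it
-- charged to each end. A poor vertex has three places, so a locally optimal bipartition leaves at
-- most one such chain there, a net gain of at least 3/2: enough from income 7, but possibly 1/2 too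
-- little from income 6. The missing 1/2 comes from the Roman side: a selected vertex saves 3 and
-- gives 1/2 along each of its at most three ties.
--
-- The cycle C5 costs 7, more than 20/3, and deleting the edge by which a five-cycle hangs would
-- isolate it. Left hanging it costs only 6 if its vertex next to the foot is dominated by the foot.
-- The 2 thirds that remain are what the poorest chain end pays, so a pendant counts as an end at
-- its foot.

-- Stands in for linear arithmetic: a known inequality `A ≤ B` and a slack `s` reduce the goal to an
-- identity for the ring solver.
≤-linear : ∀ {x y A B} s → A ≤ B → x + B + s ≡ y + A → x ≤ y
≤-linear {x} {y} {A} {B} s A≤B eq = +-cancelʳ-≤ B x y (begin
  x + B      ≤⟨ m≤m+n (x + B) s ⟩
  x + B + s  ≡⟨ eq ⟩
  y + A      ≤⟨ +-monoʳ-≤ y A≤B ⟩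
  y + B      ∎)
  where open ≤-Reasoning

-- Sums over lists

module _ {A : Set} where

  ⅀ : (A → ℕ) → List A → ℕ
  ⅀ f xs = sum (map f xs)

  ⅀-++ : ∀ f xs ys → ⅀ f (xs ++ ys) ≡ ⅀ f xs + ⅀ f ys
  ⅀-++ f xs ys = trans (cong sum (map-++ f xs ys)) (sum-++ (map f xs) (map f ys))

  ⅀-↭ : ∀ f {xs ys} → xs ↭ ys → ⅀ f xs ≡ ⅀ f ys
  ⅀-↭ f p = sum-↭ (map⁺ f p)

  ⅀-cong : ∀ {f g} xs → (∀ {x} → x ∈ xs → f x ≡ g x) → ⅀ f xs ≡ ⅀ g xs
  ⅀-cong []       h = refl
  ⅀-cong (x ∷ xs) h = cong₂ _+_ (h (here refl)) (⅀-cong xs (λ m → h (there m)))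

  ⅀-mono : ∀ {f g} xs → (∀ {x} → x ∈ xs → f x ≤ g x) → ⅀ f xs ≤ ⅀ g xs
  ⅀-mono []       h = z≤n
  ⅀-mono (x ∷ xs) h = +-mono-≤ (h (here refl)) (⅀-mono xs (λ m → h (there m)))

  ⅀-+ : ∀ f g xs → ⅀ (λ x → f x + g x) xs ≡ ⅀ f xs + ⅀ g xs
  ⅀-+ f g []       = refl
  ⅀-+ f g (x ∷ xs) = trans (cong (f x + g x +_) (⅀-+ f g xs)) (lemma (f x) (g x) _ _)
    where
    lemma : ∀ a b c d → a + b + (c + d) ≡ a + c + (b + d)
    lemma = solve-∀

  ⅀-* : ∀ k f xs → ⅀ (λ x → k * f x) xs ≡ k * ⅀ f xs
  ⅀-* k f []       = sym (*-zeroʳ k)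
  ⅀-* k f (x ∷ xs) = trans (cong (k * f x +_) (⅀-* k f xs)) (sym (*-distribˡ-+ k (f x) _))

  ⅀-zero : ∀ xs → ⅀ (λ _ → 0) xs ≡ 0
  ⅀-zero []       = refl
  ⅀-zero (x ∷ xs) = ⅀-zero xs

  ⅀-const : ∀ k xs → ⅀ (λ _ → k) xs ≡ k * length xs
  ⅀-const k []       = sym (*-zeroʳ k)
  ⅀-const k (x ∷ xs) = trans (cong (k +_) (⅀-const k xs)) (sym (*-suc k _))

  ∈⇒≤⅀ : ∀ f {x xs} → x ∈ xs → f x ≤ ⅀ f xs
  ∈⇒≤⅀ f {xs = _ ∷ xs} (here refl) = m≤m+n _ _
  ∈⇒≤⅀ f {xs = y ∷ xs} (there m)   = ≤-trans (∈⇒≤⅀ f m) (m≤n+m _ (f y))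

  ⅀-mono-at : ∀ {f g} c {x} xs → (∀ {y} → y ∈ xs → g y ≤ f y) → x ∈ xs → g x + c ≤ f x →
              ⅀ g xs + c ≤ ⅀ f xs
  ⅀-mono-at {f} {g} c (x ∷ xs) h (here refl) le = ≤-trans
    (≤-reflexive (lemma (g x) (⅀ g xs) c)) (+-mono-≤ le (⅀-mono xs (λ m → h (there m))))
    where
    lemma : ∀ a b c → a + b + c ≡ a + c + b
    lemma = solve-∀
  ⅀-mono-at {f} {g} c (y ∷ xs) h (there m) le = ≤-trans
    (≤-reflexive (+-assoc (g y) _ c))
    (+-mono-≤ (h (here refl)) (⅀-mono-at c xs (λ m → h (there m)) m le))

  ⅀≡0⇒ : ∀ f {x} xs → ⅀ f xs ≡ 0 → x ∈ xs → f x ≡ 0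
  ⅀≡0⇒ f xs eq m = n≤0⇒n≡0 (≤-trans (∈⇒≤⅀ f m) (≤-reflexive eq))

  positive-term : ∀ f xs → 1 ≤ ⅀ f xs → ∃ λ x → x ∈ xs × 1 ≤ f x
  positive-term f (x ∷ xs) le with f x in eq
  ... | suc k = x , here refl , subst (1 ≤_) (sym eq) (s≤s z≤n)
  ... | zero with positive-term f xs le
  ...   | y , m , q = y , there m , q

  ∈⇒↭ : ∀ {x} {xs : List A} → x ∈ xs → ∃ λ ys → xs ↭ x ∷ ys
  ∈⇒↭ m with ∈-∃++ m
  ... | ys , zs , refl = ys ++ zs , shift _ ys zs

⅀-map : {A B : Set} (g : A → B) (f : B → ℕ) (xs : List A) → ⅀ f (map g xs) ≡ ⅀ (λ x → f (g x)) xs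
⅀-map g f xs = cong sum (sym (map-∘ xs))

⅀-concatMap : {A B : Set} (g : A → List B) (f : B → ℕ) (xs : List A) →
              ⅀ f (concatMap g xs) ≡ ⅀ (λ x → ⅀ f (g x)) xs
⅀-concatMap g f []       = refl
⅀-concatMap g f (x ∷ xs) = trans (⅀-++ f (g x) _) (cong (⅀ f (g x) +_) (⅀-concatMap g f xs))

⅀-swap : {A B : Set} (f : A → B → ℕ) (xs : List A) (ys : List B) →
         ⅀ (λ x → ⅀ (f x) ys) xs ≡ ⅀ (λ y → ⅀ (λ x → f x y) xs) ys
⅀-swap f []       ys = sym (⅀-zero ys)
⅀-swap f (x ∷ xs) ys = trans (cong (⅀ (f x) ys +_) (⅀-swap f xs ys)) (sym (⅀-+ (f x) _ ys))

⅀1≡length : {A : Set} (xs : List A) → ⅀ (λ _ → 1) xs ≡ length xs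
⅀1≡length xs = trans (⅀-const 1 xs) (*-identityˡ _)

length-concatMap : {A B : Set} (g : A → List B) (xs : List A) →
                   length (concatMap g xs) ≡ ⅀ (λ x → length (g x)) xs
length-concatMap g xs = trans (sym (⅀1≡length (concatMap g xs)))
  (trans (⅀-concatMap g _ xs) (⅀-cong xs (λ {x} _ → ⅀1≡length (g x))))

module _ {n : ℕ} where

  δ : Fin n → Fin n → ℕ
  δ v x = b2n (does (v ≟ x))

  δ-refl : ∀ v → δ v v ≡ 1
  δ-refl v with v ≟ v
  ... | yes _ = refl
  ... | no v≢v = ⊥-elim (v≢v refl)

  δ-≢ : ∀ {v x} → v ≢ x → δ v x ≡ 0
  δ-≢ {v} {x} v≢x with v ≟ x
  ... | yes v≡x = ⊥-elim (v≢x v≡x)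
  ... | no _ = refl

  1≤δ⇒≡ : ∀ {v x} → 1 ≤ δ v x → v ≡ x
  1≤δ⇒≡ {v} {x} le with v ≟ x
  ... | yes v≡x = v≡x

  δ≡0⇒≢ : ∀ {v x} → δ v x ≡ 0 → v ≢ x
  δ≡0⇒≢ {v} eq refl with trans (sym (δ-refl v)) eq
  ... | ()

  ⅀-δ-absent : ∀ {x} (g : Fin n → ℕ) vs → All (x ≢_) vs → ⅀ (λ v → δ v x * g v) vs ≡ 0
  ⅀-δ-absent g []       []         = refl
  ⅀-δ-absent {x} g (v ∷ vs) (x≢v ∷ ps) = trans
    (cong (λ d → d * g v + ⅀ (λ v → δ v x * g v) vs) (δ-≢ (λ e → x≢v (sym e)))) (⅀-δ-absent g vs ps)

  ⅀-δ : ∀ {x} (g : Fin n → ℕ) vs → Unique vs → x ∈ vs → ⅀ (λ v → δ v x * g v) vs ≡ g x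
  ⅀-δ {x} g (v ∷ vs) (ps ∷ _) (here refl) = trans
    (cong₂ _+_ (cong (_* g v) (δ-refl v)) (⅀-δ-absent g vs ps)) (lemma (g v))
    where
    lemma : ∀ a → 1 * a + 0 ≡ a
    lemma = solve-∀
  ⅀-δ {x} g (v ∷ vs) (ps ∷ u) (there m) = trans
    (cong (λ d → d * g v + ⅀ (λ v → δ v x * g v) vs) (δ-≢ (All.lookup ps m))) (⅀-δ g vs u m)

Unique-↭ : {A : Set} {xs ys : List A} → xs ↭ ys → Unique xs → Unique ys
Unique-↭ p = Permₛ.Unique-resp-↭ (setoid _) (↭⇒↭ₛ p)

-- Labellings and domination for both rules at once

-- Both kinds of domination follow one scheme: every needy vertex must see, for
-- each colour, a neighbour having that colour.
record Rule : Set₁ where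
  field
    Λ      : Set
    Colour : Set
    Needy  : Λ → Set
    Has    : Λ → Colour → Set
    wt     : Λ → ℕ

rainbow : Rule
rainbow = record
  { Λ      = Label2
  ; Colour = Bool
  ; Needy  = IsEmptyLabel
  ; Has    = λ { (a , _) true → a ≡ true ; (_ , b) false → b ≡ true }
  ; wt     = λ l → b2n (proj₁ l) + b2n (proj₂ l)
  }

roman : Rule
roman = record
  { Λ      = Fin 3
  ; Colour = ⊤
  ; Needy  = λ l → toℕ l ≡ 0
  ; Has    = λ l _ → toℕ l ≡ 2
  ; wt     = toℕ
  }

module Fitting (R : Rule) where
  open Rule R

  first : List Λ → Λ → Λ
  first []      r = r
  first (w ∷ _) _ = w

  -- Only the letters in between have to be satisfied; `l` and `r` help from the two ends.
  Fits : Λ → List Λ → Λ → Set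
  Fits l []       r = ⊤
  Fits l (w ∷ ws) r = (Needy w → ∀ c → Has l c ⊎ Has (first ws r) c) × Fits w ws r

module _ {n : ℕ} (G : Graph n) where

  data Walk : Fin n → List (Fin n) → Fin n → Set where
    last : ∀ {x y} → Adj G x y → Walk x [] y
    _∷_  : ∀ {x a p y} → Adj G x a → Walk a p y → Walk x (a ∷ p) y

  Adj-sym : ∀ {x y} → Adj G x y → Adj G y x
  Adj-sym {x} {y} e = trans (Graph.sym G y x) e

  Adj-≢ : ∀ {x y} → Adj G x y → x ≢ y
  Adj-≢ {x} e refl with trans (sym e) (irrefl G x)
  ... | ()

  module Labels (R : Rule) where
    open Rule R
    open Fitting R

    Labelled : Set
    Labelled = List (Fin n × Λ)

    weight : Labelled → ℕ
    weight = ⅀ (wt ∘ proj₂)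

    Supplied : Labelled → Fin n → Colour → Set
    Supplied O v c = ∃ λ u → ∃ λ l → (u , l) ∈ O × Adj G v u × Has l c

    Dom : Labelled → Labelled → Set
    Dom O F = ∀ {v l} → (v , l) ∈ F → Needy l → ∀ c → Supplied O v c

    Supplied-⊆ : ∀ {O O′ v c} → O ⊆ O′ → Supplied O v c → Supplied O′ v c
    Supplied-⊆ s (u , l , m , e , h) = u , l , s m , e , h

    Dom-⊆ : ∀ {O O′ F} → O ⊆ O′ → Dom O F → Dom O′ F
    Dom-⊆ s d m nd c = Supplied-⊆ s (d m nd c)

    Dom-++ : ∀ {O} F {F′} → Dom O F → Dom O F′ → Dom O (F ++ F′)
    Dom-++ F d d′ m with ∈-++⁻ F m
    ... | inj₁ m₁ = d m₁
    ... | inj₂ m₂ = d′ m₂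

    -- `O` gives `x` at least the colours of `L`. Patterns are designed for an idealised end label,
    -- which may be weaker than the actual one.
    Stands : Labelled → Fin n → Λ → Set
    Stands O x L = ∀ c → Has L c → ∃ λ l → (x , l) ∈ O × Has l c

    Dom-walk : ∀ {O x p y L ws r} → Walk x p y → length ws ≡ length p → Fits L ws r →
               Stands O x L → Stands O y r → zip p ws ⊆ O → Dom O (zip p ws)
    Dom-walk {O} {x} {a ∷ p} {y} {L} {w ∷ ws} {r} (e ∷ es) eq (ok , oks) sx sy sub (here refl) nd c
      with ok nd c
    ... | inj₁ h = let l , m , h′ = sx c h in x , l , m , Adj-sym e , h′
    ... | inj₂ h = next p ws es eq sub h
      where
      next : ∀ p ws → Walk a p y → length (w ∷ ws) ≡ length (a ∷ p) →
             zip (a ∷ p) (w ∷ ws) ⊆ O → Has (first ws r) c → Supplied O a c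
      next []      []       (last e)  _ sub h = let l , m , h′ = sy c h in y , l , m , e , h′
      next (b ∷ p) (v ∷ ws) (e ∷ _)   _ sub h = b , v , sub (there (here refl)) , e , h
    Dom-walk {p = a ∷ p} {ws = w ∷ ws} (e ∷ es) eq (ok , oks) sx sy sub (there m) =
      Dom-walk es (suc-injective eq) oks (λ c h → w , sub (here refl) , h) sy (sub ∘ there) m

    map-proj₁-zip : ∀ (p : List (Fin n)) (ws : List Λ) → length ws ≡ length p → map proj₁ (zip p ws) ≡ p
    map-proj₁-zip []      []       _  = refl
    map-proj₁-zip (a ∷ p) (w ∷ ws) eq = cong (a ∷_) (map-proj₁-zip p ws (suc-injective eq))

    weight-zip : ∀ (p : List (Fin n)) (ws : List Λ) → length ws ≡ length p → weight (zip p ws) ≡ ⅀ wt ws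
    weight-zip []      []       _  = refl
    weight-zip (a ∷ p) (w ∷ ws) eq = cong (wt w +_) (weight-zip p ws (suc-injective eq))

    -- Labels for `I` that may lean on outer labels `O`, which need not be dominated themselves;
    -- `Labelling` is the self-contained form.
    record Block (O : Labelled) (I : List (Fin n)) (k : ℕ) : Set where
      constructor block
      field
        labels   : Labelled
        vertices : map proj₁ labels ≡ I
        dom      : Dom (O ++ labels) labels
        cost     : weight labels ≤ k

    open Block

    chain-block : ∀ {O x p y L r k} ws → Walk x p y → length ws ≡ length p → Fits L ws r →
                  ⅀ wt ws ≤ k → Stands O x L → Stands O y r → Block O p k
    chain-block {O} {p = p} ws w eq fit le sx sy = block (zip p ws) (map-proj₁-zip p ws eq)
      (Dom-walk w eq fit (up sx) (up sy) (∈-++⁺ʳ O)) (≤-trans (≤-reflexive (weight-zip p ws eq)) le)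
      where
      up : ∀ {x L} → Stands O x L → Stands (O ++ zip p ws) x L
      up s c h = let l , m , h′ = s c h in l , ∈-++⁺ˡ m , h′

    ++-monoʳ-⊆ : ∀ (O : Labelled) {F F′} → F ⊆ F′ → O ++ F ⊆ O ++ F′
    ++-monoʳ-⊆ O s m with ∈-++⁻ O m
    ... | inj₁ m₁ = ∈-++⁺ˡ m₁
    ... | inj₂ m₂ = ∈-++⁺ʳ O (s m₂)

    block-++ : ∀ {O I J k l} → Block O I k → Block O J l → Block O (I ++ J) (k + l)
    block-++ {O} (block F v d c) (block F′ v′ d′ c′) = block (F ++ F′)
      (trans (map-++ proj₁ F F′) (cong₂ _++_ v v′))
      (Dom-++ F (Dom-⊆ (++-monoʳ-⊆ O ∈-++⁺ˡ) d) (Dom-⊆ (++-monoʳ-⊆ O (∈-++⁺ʳ F)) d′))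
      (≤-trans (≤-reflexive (⅀-++ (wt ∘ proj₂) F F′)) (+-mono-≤ c c′))

    -- `P` is a fact about one block that survives the addition of others; it later carries the
    -- domination of a foot by its pendant through the union.
    blocks : ∀ {O} {B : Set} (ints : B → List (Fin n)) (k : B → ℕ) (P : B → Labelled → Set) →
             (∀ {b F F′} → F ⊆ F′ → P b F → P b F′) → (bs : List B) →
             (∀ {b} → b ∈ bs → ∃ λ (X : Block O (ints b) (k b)) → P b (labels X)) →
             ∃ λ (X : Block O (concatMap ints bs) (⅀ k bs)) → ∀ {b} → b ∈ bs → P b (labels X)
    blocks ints k P mono []       h = block [] refl (λ ()) z≤n , λ ()
    blocks ints k P mono (b ∷ bs) h with h (here refl) | blocks ints k P mono bs (h ∘ there)
    ... | X , p | Y , q = block-++ X Y ,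
      λ { (here refl) → mono ∈-++⁺ˡ p ; (there m) → mono (∈-++⁺ʳ (labels X)) (q m) }

    record Labelling (S : List (Fin n)) (k : ℕ) : Set where
      constructor labelling
      field
        labels   : Labelled
        vertices : map proj₁ labels ↭ S
        dom      : Dom labels labels
        cost     : weight labels ≤ k

    labelling-++ : ∀ {S S′ k k′} → Labelling S k → Labelling S′ k′ → Labelling (S ++ S′) (k + k′)
    labelling-++ (labelling F v d c) (labelling F′ v′ d′ c′) = labelling (F ++ F′)
      (↭-trans (↭-reflexive (map-++ proj₁ F F′)) (++⁺ v v′))
      (Dom-++ F (Dom-⊆ ∈-++⁺ˡ d) (Dom-⊆ (∈-++⁺ʳ F) d′))
      (≤-trans (≤-reflexive (⅀-++ (wt ∘ proj₂) F F′)) (+-mono-≤ c c′))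

    labelling-↭ : ∀ {S S′ k} → S ↭ S′ → Labelling S k → Labelling S′ k
    labelling-↭ p (labelling F v d c) = labelling F (↭-trans v p) d c

    labelWith : (Fin n → Λ) → List (Fin n) → Labelled
    labelWith f = map (λ v → v , f v)

    ∈-labelWith : ∀ f {v vs} → v ∈ vs → (v , f v) ∈ labelWith f vs
    ∈-labelWith f m = ∈-map⁺ (λ v → v , f v) m

    labelWith-vertices : ∀ f vs → map proj₁ (labelWith f vs) ≡ vs
    labelWith-vertices f []       = refl
    labelWith-vertices f (v ∷ vs) = cong (v ∷_) (labelWith-vertices f vs)

    close : ∀ f vs {I k} (X : Block (labelWith f vs) I k) →
            (∀ {v} → v ∈ vs → Needy (f v) → ∀ c → Supplied (labelWith f vs ++ labels X) v c) →
            Labelling (vs ++ I) (⅀ (wt ∘ f) vs + k)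
    close f vs (block F v d c) dvs = labelling (labelWith f vs ++ F)
      (↭-reflexive (trans (map-++ proj₁ (labelWith f vs) F) (cong₂ _++_ (labelWith-vertices f vs) v)))
      (Dom-++ (labelWith f vs) dom-vs d)
      (≤-trans (≤-reflexive (trans (⅀-++ (wt ∘ proj₂) (labelWith f vs) F)
                                   (cong (_+ weight F) (⅀-map (λ v → v , f v) (wt ∘ proj₂) vs))))
               (+-monoʳ-≤ _ c))
      where
      dom-vs : Dom (labelWith f vs ++ F) (labelWith f vs)
      dom-vs m nd with ∈-map⁻ (λ v → v , f v) m
      ... | v , v∈ , refl = dvs v∈ nd

    Dominating : (Fin n → Λ) → Set
    Dominating f = ∀ u → Needy (f u) → ∀ c → ∃ λ v → Adj G u v × Has (f v) c

    label-unique : ∀ {v l l′} (F : Labelled) → Unique (map proj₁ F) → (v , l) ∈ F → (v , l′) ∈ F → l ≡ l′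
    label-unique (_ ∷ F) u       (here refl) (here refl) = refl
    label-unique (_ ∷ F) (a ∷ u) (here refl) (there m)   = ⊥-elim (All.lookup a (∈-map⁺ proj₁ m) refl)
    label-unique (_ ∷ F) (a ∷ u) (there m)   (here refl) = ⊥-elim (All.lookup a (∈-map⁺ proj₁ m) refl)
    label-unique (_ ∷ F) (a ∷ u) (there m)   (there m′)  = label-unique F u m m′

    labelling⇒function : ∀ {k} → Labelling (allFin n) k → ∃ λ f → Dominating f × Σᵥ (wt ∘ f) ≤ k
    labelling⇒function (labelling F v d c) = f , dominating , le
      where
      labelOf : ∀ u → ∃ λ l → (u , l) ∈ F
      labelOf u with ∈-map⁻ proj₁ (∈-resp-↭ (↭-sym v) (∈-allFin u))
      ... | (_ , l) , m , refl = l , m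
      f : Fin n → Λ
      f u = proj₁ (labelOf u)
      f-≡ : ∀ {u l} → (u , l) ∈ F → f u ≡ l
      f-≡ m = label-unique F (Unique-↭ (↭-sym v) (allFin⁺ n)) (proj₂ (labelOf _)) m
      dominating : Dominating f
      dominating u nd c with d (proj₂ (labelOf u)) nd c
      ... | w , l , m , e , h = w , e , subst (λ l → Has l c) (sym (f-≡ m)) h
      le : Σᵥ (wt ∘ f) ≤ _
      le = ≤-trans (≤-reflexive (trans (⅀-↭ (wt ∘ f) (↭-sym v)) (trans (⅀-map proj₁ (wt ∘ f) F)
             (⅀-cong F (λ m → cong wt (f-≡ m)))))) c

  module Rb = Labels rainbow
  module Rm = Labels roman

  Good : List (Fin n) → Set
  Good S = ∃ λ a → ∃ λ b → Rb.Labelling S a × Rm.Labelling S b × 3 * (a + b) ≤ 4 * length S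

  Good-↭ : ∀ {S S′} → S ↭ S′ → Good S → Good S′
  Good-↭ p (a , b , f , g , le) = a , b , Rb.labelling-↭ p f , Rm.labelling-↭ p g ,
    subst (λ k → 3 * (a + b) ≤ 4 * k) (↭-length p) le

  Good-++ : ∀ {S S′} → Good S → Good S′ → Good (S ++ S′)
  Good-++ {S} {S′} (a , b , f , g , le) (a′ , b′ , f′ , g′ , le′) =
    a + a′ , b + b′ , Rb.labelling-++ f f′ , Rm.labelling-++ g g′ ,
    (begin
      3 * (a + a′ + (b + b′))      ≡⟨ lemma a a′ b b′ ⟩
      3 * (a + b) + 3 * (a′ + b′)  ≤⟨ +-mono-≤ le le′ ⟩
      4 * length S + 4 * length S′ ≡⟨ *-distribˡ-+ 4 (length S) _ ⟨
      4 * (length S + length S′)   ≡⟨ cong (4 *_) (length-++ S) ⟨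
      4 * length (S ++ S′)         ∎)
    where
    open ≤-Reasoning
    lemma : ∀ a a′ b b′ → 3 * (a + a′ + (b + b′)) ≡ 3 * (a + b) + 3 * (a′ + b′)
    lemma = solve-∀

-- Label patterns along a chain

data Res : Set where
  r₀ r₁ r₂ : Res

res : ℕ → Res
res 0 = r₀
res 1 = r₁
res 2 = r₂
res (suc (suc (suc k))) = res k

half : Res → ℕ
half r₀ = 3
half r₁ = 2
half r₂ = 4

-- What the interior of a chain with k inner vertices costs in either labelling
-- when both ends carry the strongest label; the value at 0 is junk.
base : ℕ → ℕ
base 0 = 0
base 1 = 0
base 2 = 0
base 3 = 1
base (suc (suc (suc k@(suc _)))) = 2 + base k

-- 4k/3 - 2 (base k) is what a chain contributes to the discharging; each of
-- its two ends receives a half of it (values of half are in thirds).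
base-half : ∀ k → 6 * base (suc k) + 2 * half (res (suc k)) ≡ 4 * suc k
base-half 0 = refl
base-half 1 = refl
base-half 2 = refl
base-half (suc (suc (suc k))) = trans (lemma (base (suc k)) (half (res (suc k))))
  (trans (cong (12 +_) (base-half k)) (lemma′ k))
  where
  lemma : ∀ b h → 6 * (2 + b) + 2 * h ≡ 12 + (6 * b + 2 * h)
  lemma = solve-∀
  lemma′ : ∀ k → 12 + 4 * suc k ≡ 4 * suc (suc (suc (suc k)))
  lemma′ = solve-∀

2≤half : ∀ r → 2 ≤ half r
2≤half r₀ = s≤s (s≤s z≤n)
2≤half r₁ = s≤s (s≤s z≤n)
2≤half r₂ = s≤s (s≤s z≤n)

record Pattern (R : Rule) (l r : Rule.Λ R) (k c : ℕ) : Set where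
  constructor mkPattern
  open Rule R
  open Fitting R
  field
    labels : List Λ
    len    : length labels ≡ k
    fits   : Fits l labels r
    cost   : ⅀ wt labels ≤ c

one : Bool → Label2
one s = s , not s

two : Label2
two = true , true

none : Label2
none = false , false

colour : Bool → Bool → Label2
colour a s = if a then one s else two

-- The colours for which a chain between two one-coloured ends exceeds `base`. A single inner vertex
-- wants different ends; of three inner vertices the middle one supplies the missing colour, which
-- wants equal ends. At residue 2 one-coloured ends are excluded.
conflict : Res → Bool → Bool → Bool
conflict r₀ s s′ = s xor s′
conflict r₁ s s′ = not (s xor s′)
conflict r₂ s s′ = false

-- Three further vertices cost 2 in either labelling: the label of the left end
-- is repeated on the third of them.
rainbow-+3 : ∀ a s {r k c} → Pattern rainbow (colour a s) r k c → Pattern rainbow (colour a s) r (3 + k) (2 + c)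
rainbow-+3 true true (mkPattern ws len fits cost) = mkPattern (none ∷ one false ∷ one true ∷ ws)
  (cong (3 +_) len)
  ((λ { _ true → inj₁ refl ; _ false → inj₂ refl }) , (λ { (_ , ()) }) , (λ { (() , _) }) , fits)
  (s≤s (s≤s cost))
rainbow-+3 true false (mkPattern ws len fits cost) = mkPattern (none ∷ one true ∷ one false ∷ ws)
  (cong (3 +_) len)
  ((λ { _ true → inj₂ refl ; _ false → inj₁ refl }) , (λ { (() , _) }) , (λ { (_ , ()) }) , fits)
  (s≤s (s≤s cost))
rainbow-+3 false s (mkPattern ws len fits cost) = mkPattern (none ∷ none ∷ two ∷ ws)
  (cong (3 +_) len)
  ((λ { _ true → inj₁ refl ; _ false → inj₁ refl }) , (λ { _ true → inj₂ refl ; _ false → inj₂ refl }) ,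
   (λ { (() , _) }) , fits)
  (s≤s (s≤s cost))

-- Two empty inner vertices see only one labelled end each, so the cost 0 at length 2 forces both
-- ends to carry both colours; hence the hypothesis.
rainbow-pattern : ∀ k a s a′ s′ → (res (suc k) ≡ r₂ → a ≡ false × a′ ≡ false) →
  Pattern rainbow (colour a s) (colour a′ s′) (suc k)
          (base (suc k) + b2n (a ∧ a′ ∧ conflict (res (suc k)) s s′))
rainbow-pattern 0 true true true true _ = mkPattern (one true ∷ []) refl ((λ { (() , _) }) , tt) ≤-refl
rainbow-pattern 0 true true true false _ = mkPattern (none ∷ []) refl
  ((λ { _ true → inj₁ refl ; _ false → inj₂ refl }) , tt) ≤-refl
rainbow-pattern 0 true false true true _ = mkPattern (none ∷ []) refl
  ((λ { _ true → inj₂ refl ; _ false → inj₁ refl }) , tt) ≤-refl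
rainbow-pattern 0 true false true false _ = mkPattern (one true ∷ []) refl ((λ { (() , _) }) , tt) ≤-refl
rainbow-pattern 0 true s false s′ _ = mkPattern (none ∷ []) refl
  ((λ { _ true → inj₂ refl ; _ false → inj₂ refl }) , tt) ≤-refl
rainbow-pattern 0 false s a′ s′ _ = mkPattern (none ∷ []) refl
  ((λ { _ true → inj₁ refl ; _ false → inj₁ refl }) , tt) z≤n
rainbow-pattern 1 true s a′ s′ h with h refl
... | () , _
rainbow-pattern 1 false s true s′ h with h refl
... | _ , ()
rainbow-pattern 1 false s false s′ _ = mkPattern (none ∷ none ∷ []) refl
  ((λ { _ true → inj₁ refl ; _ false → inj₁ refl }) , (λ { _ true → inj₂ refl ; _ false → inj₂ refl }) , tt) z≤n
rainbow-pattern 2 true true true true _ = mkPattern (none ∷ one false ∷ none ∷ []) refl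
  ((λ { _ true → inj₁ refl ; _ false → inj₂ refl }) , (λ { (_ , ()) }) ,
   (λ { _ true → inj₂ refl ; _ false → inj₁ refl }) , tt) ≤-refl
rainbow-pattern 2 true false true false _ = mkPattern (none ∷ one true ∷ none ∷ []) refl
  ((λ { _ true → inj₂ refl ; _ false → inj₁ refl }) , (λ { (() , _) }) ,
   (λ { _ true → inj₁ refl ; _ false → inj₂ refl }) , tt) ≤-refl
rainbow-pattern 2 true true true false _ = mkPattern (none ∷ one false ∷ one true ∷ []) refl
  ((λ { _ true → inj₁ refl ; _ false → inj₂ refl }) , (λ { (_ , ()) }) , (λ { (() , _) }) , tt) ≤-refl
rainbow-pattern 2 true false true true _ = mkPattern (none ∷ one true ∷ one true ∷ []) refl
  ((λ { _ true → inj₂ refl ; _ false → inj₁ refl }) , (λ { (() , _) }) , (λ { (() , _) }) , tt) ≤-refl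
rainbow-pattern 2 true true false s′ _ = mkPattern (none ∷ one false ∷ none ∷ []) refl
  ((λ { _ true → inj₁ refl ; _ false → inj₂ refl }) , (λ { (_ , ()) }) ,
   (λ { _ true → inj₂ refl ; _ false → inj₂ refl }) , tt) ≤-refl
rainbow-pattern 2 true false false s′ _ = mkPattern (none ∷ one true ∷ none ∷ []) refl
  ((λ { _ true → inj₂ refl ; _ false → inj₁ refl }) , (λ { (() , _) }) ,
   (λ { _ true → inj₂ refl ; _ false → inj₂ refl }) , tt) ≤-refl
rainbow-pattern 2 false s true true _ = mkPattern (none ∷ one false ∷ none ∷ []) refl
  ((λ { _ true → inj₁ refl ; _ false → inj₁ refl }) , (λ { (_ , ()) }) ,
   (λ { _ true → inj₂ refl ; _ false → inj₁ refl }) , tt) ≤-refl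
rainbow-pattern 2 false s true false _ = mkPattern (none ∷ one true ∷ none ∷ []) refl
  ((λ { _ true → inj₁ refl ; _ false → inj₁ refl }) , (λ { (() , _) }) ,
   (λ { _ true → inj₁ refl ; _ false → inj₂ refl }) , tt) ≤-refl
rainbow-pattern 2 false s false s′ _ = mkPattern (none ∷ one false ∷ none ∷ []) refl
  ((λ { _ true → inj₁ refl ; _ false → inj₁ refl }) , (λ { (_ , ()) }) ,
   (λ { _ true → inj₂ refl ; _ false → inj₂ refl }) , tt) ≤-refl
rainbow-pattern (suc (suc (suc k))) a s a′ s′ h = rainbow-+3 a s (rainbow-pattern k a s a′ s′ h)

-- For loops the penalty of rainbow-pattern can be avoided.
rainbow-loop : ∀ k a s → res (suc (suc k)) ≡ r₁ →
  Pattern rainbow (colour a s) (colour a s) (suc (suc k)) (base (suc (suc k)))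
rainbow-loop 2 true true _ = mkPattern (none ∷ one false ∷ none ∷ one true ∷ []) refl
  ((λ { _ true → inj₁ refl ; _ false → inj₂ refl }) , (λ { (_ , ()) }) ,
   (λ { _ true → inj₂ refl ; _ false → inj₁ refl }) , (λ { (() , _) }) , tt) ≤-refl
rainbow-loop 2 true false _ = mkPattern (none ∷ one true ∷ none ∷ one false ∷ []) refl
  ((λ { _ true → inj₂ refl ; _ false → inj₁ refl }) , (λ { (() , _) }) ,
   (λ { _ true → inj₁ refl ; _ false → inj₂ refl }) , (λ { (_ , ()) }) , tt) ≤-refl
rainbow-loop 2 false s _ = rainbow-+3 false s (rainbow-pattern 0 false s false s (λ ()))
rainbow-loop (suc (suc (suc k))) a s h = rainbow-+3 a s (rainbow-loop k a s h)

conflict-self : ∀ a t r → r ≢ r₁ → b2n (a ∧ a ∧ conflict r t t) ≡ 0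
conflict-self false t     r  _ = refl
conflict-self true  true  r₀ _ = refl
conflict-self true  false r₀ _ = refl
conflict-self true  t     r₂ _ = refl
conflict-self true  t     r₁ ≢ = ⊥-elim (≢ refl)

-- With equal ends only residue 1 can conflict. A loop has at least two inner vertices, so that
-- residue starts at length 4, where alternating colours fit at no extra cost.
rainbow-closed : ∀ k a t → (res (suc (suc k)) ≡ r₂ → a ≡ false) →
  Pattern rainbow (colour a t) (colour a t) (suc (suc k)) (base (suc (suc k)))
rainbow-closed k a t h with res (suc (suc k)) in eq
... | r₁ = rainbow-loop k a t eq
... | r₀ = subst (Pattern rainbow (colour a t) (colour a t) (suc (suc k)))
  (trans (cong (base (suc (suc k)) +_) (conflict-self a t _ (λ e → r₀≢r₁ (trans (sym eq) e)))) (+-identityʳ _))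
  (rainbow-pattern (suc k) a t a t (λ e → ⊥-elim (r₀≢r₂ (trans (sym eq) e))))
  where
  r₀≢r₁ : r₀ ≢ r₁
  r₀≢r₁ ()
  r₀≢r₂ : r₀ ≢ r₂
  r₀≢r₂ ()
... | r₂ = subst (Pattern rainbow (colour a t) (colour a t) (suc (suc k)))
  (trans (cong (base (suc (suc k)) +_) (conflict-self a t _ (λ e → r₂≢r₁ (trans (sym eq) e)))) (+-identityʳ _))
  (rainbow-pattern (suc k) a t a t (λ _ → h refl , h refl))
  where
  r₂≢r₁ : r₂ ≢ r₁
  r₂≢r₁ ()

-- For cycles of length 8, 11, ... the weights `1 + base` and `2 + base` would together exceed the
-- bound by 1/3. Alternating colours on every second vertex of C8 save 1, and three further vertices
-- preserve the saving. The shortest case of this residue with at least two inner vertices is C5,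
-- left out here.
rainbow-cycle : ∀ k → res k ≡ r₁ →
  ∃ λ c → Pattern rainbow (one true) (one true) (6 + k) c × suc c ≡ base (6 + k)
rainbow-cycle 1 _ = 3 , mkPattern (none ∷ one false ∷ none ∷ one true ∷ none ∷ one false ∷ none ∷ []) refl
  ((λ { _ true → inj₁ refl ; _ false → inj₂ refl }) , (λ { (_ , ()) }) ,
   (λ { _ true → inj₂ refl ; _ false → inj₁ refl }) , (λ { (() , _) }) ,
   (λ { _ true → inj₁ refl ; _ false → inj₂ refl }) , (λ { (_ , ()) }) ,
   (λ { _ true → inj₂ refl ; _ false → inj₁ refl }) , tt) ≤-refl , refl
rainbow-cycle (suc (suc (suc k))) h with rainbow-cycle k h
... | c , p , eq = 2 + c , rainbow-+3 true true p , cong (2 +_) eq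

-- A selected end is treated as 0, that is, as no help to its chains, whatever its actual label.
lead : Bool → Fin 3
lead t = if t then 0F else 2F

roman-+3 : ∀ t {r k c} → Pattern roman (lead t) r k c → Pattern roman (lead t) r (3 + k) (2 + c)
roman-+3 true (mkPattern ws len fits cost) = mkPattern (0F ∷ 2F ∷ 0F ∷ ws) (cong (3 +_) len)
  ((λ _ _ → inj₂ refl) , (λ ()) , (λ _ _ → inj₁ refl) , fits) (s≤s (s≤s cost))
roman-+3 false (mkPattern ws len fits cost) = mkPattern (0F ∷ 0F ∷ 2F ∷ ws) (cong (3 +_) len)
  ((λ _ _ → inj₁ refl) , (λ _ _ → inj₂ refl) , (λ ()) , fits) (s≤s (s≤s cost))

-- Without help from one end a chain keeps its base cost only at residue 1, and there the other end
-- must help.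
Admissible : Res → Bool → Bool → Set
Admissible r₁ t t′ = t ∧ t′ ≡ false
Admissible _  t t′ = t ≡ false × t′ ≡ false

roman-pattern : ∀ k t t′ → Admissible (res (suc k)) t t′ →
  Pattern roman (lead t) (lead t′) (suc k) (base (suc k))
roman-pattern 0 false t′ _ = mkPattern (0F ∷ []) refl ((λ _ _ → inj₁ refl) , tt) z≤n
roman-pattern 0 true false _ = mkPattern (0F ∷ []) refl ((λ _ _ → inj₂ refl) , tt) z≤n
roman-pattern 1 false false _ = mkPattern (0F ∷ 0F ∷ []) refl
  ((λ _ _ → inj₁ refl) , (λ _ _ → inj₂ refl) , tt) z≤n
roman-pattern 2 false false _ = mkPattern (0F ∷ 1F ∷ 0F ∷ []) refl
  ((λ _ _ → inj₁ refl) , (λ ()) , (λ _ _ → inj₂ refl) , tt) ≤-refl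
roman-pattern 1 true _ (() , _)
roman-pattern 2 true _ (() , _)
roman-pattern 1 false true (_ , ())
roman-pattern 2 false true (_ , ())
roman-pattern (suc (suc (suc k))) t t′ h = roman-+3 t (roman-pattern k t t′ h)

concatMap-↭ : {A B : Set} (f : A → List B) {xs ys : List A} → xs ↭ ys → concatMap f xs ↭ concatMap f ys
concatMap-↭ f refl                = ↭-refl
concatMap-↭ f (prep x p)          = ++⁺ˡ (f x) (concatMap-↭ f p)
concatMap-↭ f (swap {xs} x y p)   = ↭-trans (shifts (f x) (f y))
  (++⁺ˡ (f y) (++⁺ˡ (f x) (concatMap-↭ f p)))
concatMap-↭ f (_↭_.trans p q)     = ↭-trans (concatMap-↭ f p) (concatMap-↭ f q)

-- Cycles and the house

module _ {n : ℕ} (G : Graph n) where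

  module _ (R : Rule) where
    open Rule R
    open Labels G R

    closed-walk-labelling : ∀ {v p l c} → Walk G v p v → ¬ Needy l →
                            Pattern R l l (length p) c → Labelling (v ∷ p) (wt l + c)
    closed-walk-labelling {v} {p} {l} {c} w ¬nd (mkPattern ws len fits cost) =
      subst (λ k → Labelling (v ∷ p) (k + c)) (+-identityʳ (wt l))
        (close (λ _ → l) (v ∷ []) (chain-block ws w len fits cost stands stands) (λ _ nd → ⊥-elim (¬nd nd)))
      where
      stands : Stands ((v , l) ∷ []) v l
      stands c h = l , here refl , h

  -- By `base-half` the budget is `4 + 6 * base + 2 * half`. Beyond `6 * base`, residue 2 spends 12
  -- of 12 with `two` at `v`, residue 0 spends 9 of 10 with a single colour, and residue 1 has only
  -- 8, which requires the saving of `rainbow-cycle`.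
  cycle-good : ∀ {v p} → Walk G v p v → 2 ≤ length p → length p ≢ 4 → Good G (v ∷ p)
  cycle-good {v} {p} w 2≤ ≢4 = by-length (length p) refl
    where
    admissible : ∀ r → Admissible r false false
    admissible r₀ = refl , refl
    admissible r₁ = refl
    admissible r₂ = refl , refl
    roman-cycle : ∀ {k} → suc k ≡ length p → Rm.Labelling G (v ∷ p) (2 + base (suc k))
    roman-cycle {k} eq = closed-walk-labelling roman w (λ ())
      (subst (λ m → Pattern roman 2F 2F m (base (suc k))) eq
             (roman-pattern k false false (admissible (res (suc k)))))
    good : ∀ {a b k m} → suc k ≡ length p → Rb.Labelling G (v ∷ p) a → Rm.Labelling G (v ∷ p) b →
           3 * (a + b) ≡ m → m ≤ 4 + 6 * base (suc k) + 2 * half (res (suc k)) → Good G (v ∷ p)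
    good {a} {b} {k} eq f g e le = a , b , f , g , ≤-trans (≤-reflexive e) (≤-trans le (≤-reflexive
      (trans (+-assoc 4 (6 * base (suc k)) _)
        (trans (cong (4 +_) (base-half k)) (trans (sym (*-suc 4 (suc k))) (cong (λ m → 4 * suc m) eq))))))
    by-res : ∀ k → suc k ≡ length p → 2 ≤ suc k → suc k ≢ 4 → ∀ r → res (suc k) ≡ r → Good G (v ∷ p)
    by-res k eq 2≤ ≢4 r₂ er = good eq
      (closed-walk-labelling rainbow w (λ { (() , _) })
        (subst (λ m → Pattern rainbow two two m _) eq (rainbow-pattern k false true false true (λ _ → refl , refl))))
      (roman-cycle eq) (lemma (base (suc k))) (≤-reflexive (cong (λ r → 4 + 6 * base (suc k) + 2 * half r) (sym er)))
      where
      lemma : ∀ b → 3 * (2 + (b + 0) + (2 + b)) ≡ 4 + 6 * b + 8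
      lemma = solve-∀
    by-res k eq 2≤ ≢4 r₀ er = good eq
      (closed-walk-labelling rainbow w (λ { (() , _) })
        (subst (λ m → Pattern rainbow (one true) (one true) m _) eq
          (rainbow-pattern k true true true true (λ e → ⊥-elim (r₀≢r₂ (trans (sym er) e))))))
      (roman-cycle eq)
      (cong (λ r → 3 * (1 + (base (suc k) + b2n (conflict r true true)) + (2 + base (suc k)))) er)
      (subst (λ r → 3 * (1 + (base (suc k) + 0) + (2 + base (suc k))) ≤ 4 + 6 * base (suc k) + 2 * half r)
        (sym er) (≤-trans (n≤1+n _) (≤-reflexive (lemma (base (suc k))))))
      where
      r₀≢r₂ : r₀ ≢ r₂
      r₀≢r₂ ()
      lemma : ∀ b → 1 + 3 * (1 + (b + 0) + (2 + b)) ≡ 4 + 6 * b + 6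
      lemma = solve-∀
    by-res 0 eq (s≤s ()) ≢4 r₁ er
    by-res 3 eq 2≤ ≢4 r₁ er = ⊥-elim (≢4 refl)
    by-res (suc (suc (suc (suc (suc k))))) eq 2≤ ≢4 r₁ er with rainbow-cycle k er
    ... | c , pat , ec = good eq
      (closed-walk-labelling rainbow w (λ { (() , _) })
        (subst (λ m → Pattern rainbow (one true) (one true) m c) eq pat))
      (roman-cycle eq) refl
      (subst₂ (λ r b → 3 * (1 + c + (2 + b)) ≤ 4 + 6 * b + 2 * half r) (sym er) ec
        (≤-trans (m≤n+m _ 2) (≤-reflexive (lemma c))))
      where
      lemma : ∀ c → 2 + 3 * (1 + c + (2 + suc c)) ≡ 4 + 6 * suc c + 4
      lemma = solve-∀
    by-length : ∀ k → k ≡ length p → Good G (v ∷ p)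
    by-length zero eq = ⊥-elim (n≮0 (≤-trans 2≤ (≤-reflexive (sym eq))))
    by-length (suc k) eq = by-res k eq (subst (2 ≤_) (sym eq) 2≤) (λ e → ≢4 (trans (sym eq) e)) _ refl

  -- A triangle and a four-cycle share the edge `xy`. Strong labels on `x` reach all but `c`, so
  -- weights 3 and 3 suffice, and 18 ≤ 20.
  house-good : ∀ {x y a b c} → Adj G x y → Walk G x (a ∷ []) y → Walk G x (b ∷ c ∷ []) y →
               Good G (x ∷ y ∷ a ∷ b ∷ c ∷ [])
  house-good {x} {y} {a} {b} {c} xy (xa ∷ _) (xb ∷ _) = 3 , 3 ,
    Labels.labelling ((x , two) ∷ (y , none) ∷ (a , none) ∷ (b , none) ∷ (c , one true) ∷ []) ↭-refl
      (λ { (there (here refl)) _ true → x , two , here refl , Adj-sym G xy , refl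
         ; (there (here refl)) _ false → x , two , here refl , Adj-sym G xy , refl
         ; (there (there (here refl))) _ true → x , two , here refl , Adj-sym G xa , refl
         ; (there (there (here refl))) _ false → x , two , here refl , Adj-sym G xa , refl
         ; (there (there (there (here refl)))) _ true → x , two , here refl , Adj-sym G xb , refl
         ; (there (there (there (here refl)))) _ false → x , two , here refl , Adj-sym G xb , refl
         ; (here refl) (() , _)
         ; (there (there (there (there (here refl))))) (() , _) })
      ≤-refl ,
    Labels.labelling ((x , 2F) ∷ (y , 0F) ∷ (a , 0F) ∷ (b , 0F) ∷ (c , 1F) ∷ []) ↭-refl
      (λ { (there (here refl)) _ _ → x , 2F , here refl , Adj-sym G xy , refl
         ; (there (there (here refl))) _ _ → x , 2F , here refl , Adj-sym G xa , refl
         ; (there (there (there (here refl)))) _ _ → x , 2F , here refl , Adj-sym G xb , refl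
         ; (here refl) ()
         ; (there (there (there (there (here refl))))) () })
      ≤-refl ,
    m≤m+n 18 2

  walk-++ : ∀ {x p v q y} → Walk G x p v → Walk G v q y → Walk G x (p ++ v ∷ q) y
  walk-++ (last e)  w′ = e ∷ w′
  walk-++ (e ∷ w) w′ = e ∷ walk-++ w w′

  walk-reverse : ∀ {x p y} → Walk G x p y → Walk G y (reverse p) x
  walk-reverse (last e) = last (Adj-sym G e)
  walk-reverse {p = a ∷ p} (e ∷ w) = subst (λ q → Walk G _ q _) (sym (unfold-reverse a p))
    (walk-++ (walk-reverse w) (last (Adj-sym G e)))

-- Multigraphs of chains and the suppression of a vertex of degree 2

record Chain (n : ℕ) : Set where
  constructor chain
  field
    src : Fin n
    mid : List (Fin n)
    tgt : Fin n

open Chain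

empty : {A : Set} → List A → ℕ
empty []      = 1
empty (_ ∷ _) = 0

module _ {n : ℕ} where

  flip : Chain n → Chain n
  flip (chain x p y) = chain y (reverse p) x

  flip-involutive : ∀ e → flip (flip e) ≡ e
  flip-involutive (chain x p y) = cong (λ q → chain x q y) (reverse-involutive p)

  ints : List (Chain n) → List (Fin n)
  ints = concatMap mid

  inc : Fin n → Chain n → ℕ
  inc v e = δ v (src e) + δ v (tgt e)

  deg : Fin n → List (Chain n) → ℕ
  deg v = ⅀ (inc v)

  -- Counts direct edges between `x` and `y` in either orientation; the bound 1 on its sum excludes
  -- parallel ones.
  links : Fin n → Fin n → Chain n → ℕ
  links x y e = empty (mid e) * (δ x (src e) * δ y (tgt e) + δ x (tgt e) * δ y (src e))

  infix 4 _≈_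
  -- Lists of unoriented chains up to order. It is enough to turn the head, since `perm` can bring
  -- any chain there.
  data _≈_ : List (Chain n) → List (Chain n) → Set where
    perm : ∀ {es fs} → es ↭ fs → es ≈ fs
    turn : ∀ {e es} → e ∷ es ≈ flip e ∷ es
    _⟫_  : ∀ {es fs gs} → es ≈ fs → fs ≈ gs → es ≈ gs

  infixr 5 _⟫_

  ≈-sym : ∀ {es fs} → es ≈ fs → fs ≈ es
  ≈-sym (perm p)           = perm (↭-sym p)
  ≈-sym (turn {e} {es})    = subst (λ f → flip e ∷ es ≈ f ∷ es) (flip-involutive e) turn
  ≈-sym (p ⟫ q)            = ≈-sym q ⟫ ≈-sym p

  ≈-prep : ∀ {e es fs} → es ≈ fs → e ∷ es ≈ e ∷ fs
  ≈-prep (perm p) = perm (prep _ p)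
  ≈-prep turn     = perm (swap _ _ refl) ⟫ turn ⟫ perm (swap _ _ refl)
  ≈-prep (p ⟫ q)  = ≈-prep p ⟫ ≈-prep q

  ≈-⅀ : ∀ f → (∀ e → f (flip e) ≡ f e) → ∀ {es fs} → es ≈ fs → ⅀ f es ≡ ⅀ f fs
  ≈-⅀ f inv (perm p)        = ⅀-↭ f p
  ≈-⅀ f inv (turn {e} {es}) = cong (_+ ⅀ f es) (sym (inv e))
  ≈-⅀ f inv (p ⟫ q)         = trans (≈-⅀ f inv p) (≈-⅀ f inv q)

  ≈-length : ∀ {es fs} → es ≈ fs → length es ≡ length fs
  ≈-length (perm p) = ↭-length p
  ≈-length turn     = refl
  ≈-length (p ⟫ q)  = trans (≈-length p) (≈-length q)

  ≈-ints : ∀ {es fs} → es ≈ fs → ints es ↭ ints fs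
  ≈-ints (perm p)        = concatMap-↭ mid p
  ≈-ints (turn {e} {es}) = ++⁺ʳ (ints es) (↭-sym (↭-reverse (mid e)))
  ≈-ints (p ⟫ q)         = ↭-trans (≈-ints p) (≈-ints q)

  ≈-∈ : ∀ {es fs e} → es ≈ fs → e ∈ fs → e ∈ es ⊎ flip e ∈ es
  ≈-∈ (perm p) m = inj₁ (∈-resp-↭ (↭-sym p) m)
  ≈-∈ (turn {e}) (here refl) = inj₂ (here (flip-involutive e))
  ≈-∈ turn (there m) = inj₁ (there m)
  ≈-∈ {e = e} (p ⟫ q) m with ≈-∈ q m
  ... | inj₁ m′ = ≈-∈ p m′
  ... | inj₂ m′ with ≈-∈ p m′
  ...   | inj₁ m″ = inj₂ m″
  ...   | inj₂ m″ = inj₁ (subst (_∈ _) (flip-involutive e) m″)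

  deg-≈ : ∀ v {es fs} → es ≈ fs → deg v es ≡ deg v fs
  deg-≈ v = ≈-⅀ (inc v) (λ e → +-comm (δ v (tgt e)) _)

  empty-reverse : ∀ (p : List (Fin n)) → empty (reverse p) ≡ empty p
  empty-reverse p = trans (empty-length (reverse p))
    (trans (cong is-zero (length-reverse p)) (sym (empty-length p)))
    where
    is-zero : ℕ → ℕ
    is-zero zero    = 1
    is-zero (suc _) = 0
    empty-length : ∀ (p : List (Fin n)) → empty p ≡ is-zero (length p)
    empty-length []      = refl
    empty-length (_ ∷ _) = refl

  links-≈ : ∀ x y {es fs} → es ≈ fs → ⅀ (links x y) es ≡ ⅀ (links x y) fs
  links-≈ x y = ≈-⅀ (links x y) (λ e → cong₂ _*_ (empty-reverse (mid e)) (+-comm (δ x (tgt e) * _) _))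

  links-self : ∀ {x y p} → p ≡ [] → 1 ≤ links x y (chain x p y)
  links-self {x} {y} refl = subst₂ (λ a b → 1 ≤ 1 * (a * b + δ x y * δ y x)) (sym (δ-refl x)) (sym (δ-refl y)) (s≤s z≤n)

  orient : ∀ v es → 1 ≤ deg v es → ∃ λ p → ∃ λ z → ∃ λ rest → es ≈ chain v p z ∷ rest
  orient v es le with positive-term (inc v) es le
  ... | chain x p y , m , q with ∈⇒↭ m | v ≟ x | v ≟ y
  ... | rest , eq | yes refl | _        = p , y , rest , perm eq
  ... | rest , eq | no _     | yes refl = reverse p , x , rest , perm eq ⟫ turn
  orient v es le | chain x p y , m , () | rest , eq | no _ | no _

  -- Together with `v` such a loop is a five-cycle, the one cycle that exceeds the bound.
  FourLoop : Fin n → List (Chain n) → Set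
  FourLoop v es = ∃ λ p → chain v p v ∈ es × length p ≡ 4

  FourLoop-≈ : ∀ {v es fs} → es ≈ fs → FourLoop v es → FourLoop v fs
  FourLoop-≈ eq (p , m , l) with ≈-∈ (≈-sym eq) m
  ... | inj₁ m′ = p , m′ , l
  ... | inj₂ m′ = reverse p , m′ , trans (length-reverse p) l

module _ {n : ℕ} (G : Graph n) where

  -- The graph obtained from the multigraph on Vs by replacing its edges by the
  -- chains Cs is a subgraph of G.
  record Inv (Vs : List (Fin n)) (Cs : List (Chain n)) : Set where
    field
      uniq   : Unique Vs
      ends   : ∀ {e} → e ∈ Cs → src e ∈ Vs × tgt e ∈ Vs
      walk   : ∀ {e} → e ∈ Cs → Walk G (src e) (mid e) (tgt e)
      loop   : ∀ {e} → e ∈ Cs → src e ≡ tgt e → 2 ≤ length (mid e)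
      simple : ∀ x y → ⅀ (links x y) Cs ≤ 1

  open Inv public

  Inv-≈ : ∀ {Vs Cs Ds} → Cs ≈ Ds → Inv Vs Cs → Inv Vs Ds
  Inv-≈ {Vs} {Cs} {Ds} eq i = record
    { uniq   = uniq i
    ; ends   = λ m → [ ends i , (λ m → let a , b = ends i m in b , a) ]′ (≈-∈ eq m)
    ; walk   = walk′
    ; loop   = λ {e} m s → [ (λ m → loop i m s)
                           , (λ m → subst (2 ≤_) (length-reverse (mid e)) (loop i m (sym s))) ]′ (≈-∈ eq m)
    ; simple = λ x y → subst (_≤ 1) (links-≈ x y eq) (simple i x y)
    }
    where
    walk′ : ∀ {e} → e ∈ Ds → Walk G (src e) (mid e) (tgt e)
    walk′ {e} m with ≈-∈ eq m
    ... | inj₁ m′ = walk i m′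
    ... | inj₂ m′ = subst (λ q → Walk G (src e) q (tgt e)) (reverse-involutive (mid e)) (walk-reverse G (walk i m′))

  Inv-↭ : ∀ {Vs Ws Cs} → Vs ↭ Ws → Inv Vs Cs → Inv Ws Cs
  Inv-↭ p i = record
    { uniq   = Unique-↭ p (uniq i)
    ; ends   = λ m → let a , b = ends i m in ∈-resp-↭ p a , ∈-resp-↭ p b
    ; walk   = walk i
    ; loop   = loop i
    ; simple = simple i
    }

  Inv-tail : ∀ {Vs e Cs} → Inv Vs (e ∷ Cs) → Inv Vs Cs
  Inv-tail i = record
    { uniq   = uniq i
    ; ends   = ends i ∘ there
    ; walk   = walk i ∘ there
    ; loop   = loop i ∘ there
    ; simple = λ x y → ≤-trans (m≤n+m _ _) (simple i x y)
    }

  Inv-drop : ∀ {v Vs Cs} → Inv (v ∷ Vs) Cs → deg v Cs ≡ 0 → Inv Vs Cs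
  Inv-drop {v} {Vs} {Cs} i d0 with uniq i
  ... | _ ∷ u = record
    { uniq   = u
    ; ends   = λ {e} m → let a , b = ends i m ; z = ⅀≡0⇒ (inc v) Cs d0 m in
                 other a (δ≡0⇒≢ (m+n≡0⇒m≡0 _ z)) , other b (δ≡0⇒≢ (m+n≡0⇒n≡0 (δ v (src e)) z))
    ; walk   = walk i
    ; loop   = loop i
    ; simple = simple i
    }
    where
    other : ∀ {x} → x ∈ v ∷ Vs → v ≢ x → x ∈ Vs
    other (here refl) v≢x = ⊥-elim (v≢x refl)
    other (there m)   _   = m

  join : Fin n → List (Fin n) → Fin n → List (Fin n) → Fin n → Chain n
  join v p z q z′ = chain z (reverse p ++ v ∷ q) z′

  -- Either both ends at `v` belong to one loop, whose cycle leaves as `removed`, or two chains are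
  -- joined at `v` and nothing leaves. `origin` identifies the joined chain, so that a five-cycle
  -- closed by it can be traced back.
  record Contraction (v : Fin n) (Vs : List (Fin n)) (Cs : List (Chain n)) : Set where
    field
      removed : List (Fin n)
      chains  : List (Chain n)
      inv     : Inv Vs chains
      verts   : v ∷ ints Cs ↭ removed ++ ints chains
      degrees : ∀ {w} → w ≢ v → deg w chains ≡ deg w Cs
      shorter : length chains < length Cs
      cyclic  : removed ≡ [] ⊎ ∃ λ p → removed ≡ v ∷ p × ∃ λ rest → Cs ≈ chain v p v ∷ rest
      origin  : ∀ {e} → e ∈ chains → (e ∈ Cs ⊎ flip e ∈ Cs) ⊎
                ∃ λ p → ∃ λ z → ∃ λ q → ∃ λ z′ → ∃ λ rest →
                  Cs ≈ chain v p z ∷ chain v q z′ ∷ rest × e ≡ join v p z q z′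

  contract : ∀ {v Vs Cs} → Inv (v ∷ Vs) Cs → deg v Cs ≡ 2 → Contraction v Vs Cs
  contract {v} {Vs} {Cs} i d2 with orient v Cs (subst (1 ≤_) (sym d2) (s≤s z≤n))
  ... | p , z , rest , eq with v ≟ z
  ...   | yes refl = record
    { removed = v ∷ p
    ; chains  = rest
    ; inv     = Inv-drop (Inv-tail (Inv-≈ eq i)) rest0
    ; verts   = prep v (≈-ints eq)
    ; degrees = λ {w} w≢v → sym (trans (deg-≈ w eq) (cong (λ a → a + a + deg w rest) (δ-≢ w≢v)))
    ; shorter = ≤-reflexive (sym (≈-length eq))
    ; cyclic  = inj₂ (p , refl , rest , eq)
    ; origin  = λ m → inj₁ (≈-∈ eq (there m))
    }
    where
    rest0 : deg v rest ≡ 0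
    rest0 = +-cancelˡ-≡ 2 _ _ (trans (cong₂ (λ a b → a + b + deg v rest) (sym (δ-refl v)) (sym (δ-refl v)))
              (trans (sym (deg-≈ v eq)) d2))
  ...   | no v≢z with orient v rest (≤-reflexive (sym rest1))
    where
    rest1 : deg v rest ≡ 1
    rest1 = +-cancelˡ-≡ 1 _ _ (trans (cong₂ (λ a b → a + b + deg v rest) (sym (δ-refl v)) (sym (δ-≢ v≢z)))
              (trans (sym (deg-≈ v eq)) d2))
  ...     | q , z′ , rest′ , eq′ = record
    { removed = []
    ; chains  = new ∷ rest′
    ; inv     = inv′
    ; verts   = verts′
    ; degrees = degrees′
    ; shorter = ≤-reflexive (sym (≈-length eq″))
    ; cyclic  = inj₁ refl
    ; origin  = λ { (here refl) → inj₂ (p , z , q , z′ , rest′ , eq″ , refl)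
                  ; (there m) → inj₁ (≈-∈ eq″ (there (there m))) }
    }
    where
    new : Chain n
    new = join v p z q z′
    eq″ : Cs ≈ chain v p z ∷ chain v q z′ ∷ rest′
    eq″ = eq ⟫ ≈-prep eq′
    i′ : Inv (v ∷ Vs) (chain v p z ∷ chain v q z′ ∷ rest′)
    i′ = Inv-≈ eq″ i
    tail0 : δ v z′ + deg v rest′ ≡ 0
    tail0 = +-cancelˡ-≡ 2 _ _ (trans (cong₂ (λ a b → a + b + (a + δ v z′ + deg v rest′)) (sym (δ-refl v)) (sym (δ-≢ v≢z)))
              (trans (sym (deg-≈ v eq″)) d2))
    v≢z′ : v ≢ z′
    v≢z′ = δ≡0⇒≢ (m+n≡0⇒m≡0 _ tail0)
    degrees′ : ∀ {w} → w ≢ v → deg w (new ∷ rest′) ≡ deg w Cs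
    degrees′ {w} w≢v = trans (+-assoc (δ w z) (δ w z′) (deg w rest′))
      (trans (cong (λ a → a + δ w z + (a + δ w z′ + deg w rest′)) (sym (δ-≢ {v = w} {v} w≢v))) (sym (deg-≈ w eq″)))
    join-nonempty : ∀ (p q : List (Fin n)) → empty (p ++ v ∷ q) ≡ 0
    join-nonempty []      q = refl
    join-nonempty (_ ∷ _) q = refl
    -- Two direct edges from v to the same vertex are excluded by simplicity.
    2≤join : ∀ p q → z ≡ z′ → links v z (chain v p z) + links v z (chain v q z′) ≤ 1 →
             2 ≤ length (reverse p ++ v ∷ q)
    2≤join [] [] refl le = ⊥-elim (1+n≰n (≤-trans (+-mono-≤ (links-self {x = v} {z} refl) (links-self {x = v} {z} refl)) le))
    2≤join [] (_ ∷ _) _ le = s≤s (s≤s z≤n)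
    2≤join (a ∷ p) q _ le = subst (2 ≤_) (sym (trans (length-++ (reverse (a ∷ p)))
      (trans (cong (_+ suc (length q)) (length-reverse (a ∷ p))) (+-suc (suc (length p)) (length q))))) (s≤s (s≤s z≤n))
    inv′ : Inv Vs (new ∷ rest′)
    inv′ = Inv-drop (record
      { uniq   = uniq i
      ; ends   = λ { (here refl) → proj₂ (ends i′ (here refl)) , proj₂ (ends i′ (there (here refl)))
                   ; (there m) → ends i′ (there (there m)) }
      ; walk   = λ { (here refl) → walk-++ G (walk-reverse G (walk i′ (here refl))) (walk i′ (there (here refl)))
                   ; (there m) → walk i′ (there (there m)) }
      ; loop   = λ { (here refl) s → 2≤join p q s (≤-trans (m≤m+n _ (⅀ (links v z) rest′))
                       (≤-trans (≤-reflexive (+-assoc (links v z (chain v p z)) _ _)) (simple i′ v z)))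
                   ; (there m) s → loop i′ (there (there m)) s }
      ; simple = λ x y → subst (λ k → k * _ + ⅀ (links x y) rest′ ≤ 1) (sym (join-nonempty (reverse p) q))
                   (≤-trans (m≤n+m _ (links x y (chain v q z′)))
                     (≤-trans (m≤n+m _ (links x y (chain v p z))) (simple i′ x y)))
      }) (cong₂ _+_ (cong₂ _+_ (δ-≢ v≢z) (δ-≢ v≢z′)) (m+n≡0⇒n≡0 (δ v z′) tail0))
    verts′ : v ∷ ints Cs ↭ ints (new ∷ rest′)
    verts′ = ↭-trans (prep v (≈-ints eq″)) (↭-trans (prep v (++⁺ʳ _ (↭-sym (↭-reverse p))))
      (↭-trans (↭-sym (shift v (reverse p) _)) (↭-sym (++-assoc (reverse p) (v ∷ q) _))))

-- Discharging: local search and the greedy independent set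

-- Serves twice: for the locally optimal bipartition and for functions of minimum weight.
descend : {S : Set} {Stable : S → Set} (Φ : S → ℕ) →
          (∀ s → Stable s ⊎ ∃ λ s′ → Φ s′ < Φ s) → S → ∃ Stable
descend {S} {Stable} Φ improve s = go s (<-wellFounded (Φ s))
  where
  go : ∀ s → Acc _<_ (Φ s) → ∃ Stable
  go s (acc rs) with improve s
  ... | inj₁ st       = s , st
  ... | inj₂ (s′ , l) = go s′ (rs l)

-- Stands for a five-cycle `x a b c d` whose vertex `x` is joined to `foot`.
record Pendant (n : ℕ) : Set where
  constructor pendant
  field
    foot x a b c d : Fin n

open Pendant using (foot)

five : ∀ {n} → Pendant n → List (Fin n)
five (pendant _ x a b c d) = x ∷ a ∷ b ∷ c ∷ d ∷ []

module Discharging {n : ℕ} (G : Graph n) (Vs : List (Fin n)) (Cs : List (Chain n)) (Ps : List (Pendant n)) where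

  open Chain

  ρ : Chain n → Res
  ρ e = res (length (mid e))

  h : Chain n → ℕ
  h e = half (ρ e)

  pendants : Fin n → ℕ
  pendants v = ⅀ (λ P → δ v (foot P)) Ps

  -- Three times the share of v in the surplus of the chains and pendants at v;
  -- a vertex with the strongest labels needs 8.
  income : Fin n → ℕ
  income v = ⅀ (λ e → inc v e * h e) Cs + 2 * pendants v

  poor : Fin n → Bool
  poor v = does (income v ≤? 7)

  straight : Chain n → Bool
  straight e = not (does (src e ≟ tgt e))

  is-r₁ : Res → Bool
  is-r₁ r₀ = false
  is-r₁ r₁ = true
  is-r₁ r₂ = false

  proper : Res → Bool
  proper r₀ = true
  proper r₁ = true
  proper r₂ = false

  tie : Chain n → Bool
  tie e = straight e ∧ is-r₁ (ρ e)

  ties : Fin n → ℕ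
  ties v = ⅀ (λ e → inc v e * b2n (tie e)) Cs

  -- At a branch vertex the income is then exactly 6: three places, all chains of residue 1. With
  -- fewer than two ties no conflict is left to pay for (`hurt-lean`); with two there is no room for
  -- a loop or a second pendant.
  bare : Fin n → Bool
  bare v = does (income v ≤? 6) ∧ does (2 ≤? ties v)

  -- Marks the chains on which a wrong choice of the two colours would cost 1; `penalty` marks those
  -- on which it does.
  constraint : Chain n → ℕ
  constraint e = b2n (straight e ∧ poor (src e) ∧ poor (tgt e) ∧ proper (ρ e))

  penalty : (Fin n → Bool) → Chain n → ℕ
  penalty s e = b2n (straight e ∧ poor (src e) ∧ poor (tgt e) ∧ conflict (ρ e) (s (src e)) (s (tgt e)))

  -- The condition of a locally maximal cut: at most half of the constraints at each vertex are
  -- violated.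
  Balanced : (Fin n → Bool) → Set
  Balanced s = ∀ v → 2 * ⅀ (λ e → inc v e * penalty s e) Cs ≤ ⅀ (λ e → inc v e * constraint e) Cs

  toggle : Fin n → (Fin n → Bool) → Fin n → Bool
  toggle v s w = if does (v ≟ w) then not (s w) else s w

  -- Changing the colour of `v` exchanges violated and satisfied constraints at `v`. Both functions
  -- vanish on loops, so `inc` acts as 0 or 1.
  toggle-penalty : ∀ v s e → penalty (toggle v s) e + 2 * (inc v e * penalty s e) ≡
                             penalty s e + inc v e * constraint e
  toggle-penalty v s (chain x p y) with x ≟ y | v ≟ x | v ≟ y
  ... | yes _   | yes _    | yes _    = refl
  ... | yes _   | yes _    | no _     = refl
  ... | yes _   | no _     | yes _    = refl
  ... | yes _   | no _     | no _     = refl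
  ... | no x≢y  | yes refl | yes refl = ⊥-elim (x≢y refl)
  ... | no _    | no _     | no _     = refl
  ... | no _    | yes refl | no _     = table (poor x) (poor y) (res (length p)) (s x) (s y)
    where
    table : ∀ a b r s t → b2n (a ∧ b ∧ conflict r (not s) t) + 2 * (1 * b2n (a ∧ b ∧ conflict r s t)) ≡
                          b2n (a ∧ b ∧ conflict r s t) + 1 * b2n (a ∧ b ∧ proper r)
    table false _ _ _ _ = refl
    table true false _ _ _ = refl
    table true true r₀ false false = refl
    table true true r₀ false true = refl
    table true true r₀ true false = refl
    table true true r₀ true true = refl
    table true true r₁ false false = refl
    table true true r₁ false true = refl
    table true true r₁ true false = refl
    table true true r₁ true true = refl
    table true true r₂ _ _ = refl
  ... | no _    | no _     | yes refl = table (poor x) (poor y) (res (length p)) (s x) (s y)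
    where
    table : ∀ a b r s t → b2n (a ∧ b ∧ conflict r s (not t)) + 2 * (1 * b2n (a ∧ b ∧ conflict r s t)) ≡
                          b2n (a ∧ b ∧ conflict r s t) + 1 * b2n (a ∧ b ∧ proper r)
    table false _ _ _ _ = refl
    table true false _ _ _ = refl
    table true true r₀ false false = refl
    table true true r₀ false true = refl
    table true true r₀ true false = refl
    table true true r₀ true true = refl
    table true true r₁ false false = refl
    table true true r₁ false true = refl
    table true true r₁ true false = refl
    table true true r₁ true true = refl
    table true true r₂ _ _ = refl

  balanced : ∃ Balanced
  balanced = descend Φ improve (λ _ → true)
    where
    Φ : (Fin n → Bool) → ℕ
    Φ s = ⅀ (penalty s) Cs
    hurt limit : (Fin n → Bool) → Fin n → ℕ
    hurt s v = ⅀ (λ e → inc v e * penalty s e) Cs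
    limit s v = ⅀ (λ e → inc v e * constraint e) Cs
    Φ-toggle : ∀ s v → Φ (toggle v s) + 2 * hurt s v ≡ Φ s + limit s v
    Φ-toggle s v = begin
      Φ (toggle v s) + 2 * hurt s v
        ≡⟨ cong (Φ (toggle v s) +_) (⅀-* 2 (λ e → inc v e * penalty s e) Cs) ⟨
      Φ (toggle v s) + ⅀ (λ e → 2 * (inc v e * penalty s e)) Cs
        ≡⟨ ⅀-+ (penalty (toggle v s)) (λ e → 2 * (inc v e * penalty s e)) Cs ⟨
      ⅀ (λ e → penalty (toggle v s) e + 2 * (inc v e * penalty s e)) Cs
        ≡⟨ ⅀-cong Cs (λ {e} _ → toggle-penalty v s e) ⟩
      ⅀ (λ e → penalty s e + inc v e * constraint e) Cs
        ≡⟨ ⅀-+ (penalty s) (λ e → inc v e * constraint e) Cs ⟩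
      Φ s + limit s v ∎
      where open ≡-Reasoning
    improve : ∀ s → Balanced s ⊎ ∃ λ s′ → Φ s′ < Φ s
    improve s with all? (λ v → 2 * hurt s v ≤? limit s v)
    ... | yes b = inj₁ b
    ... | no ¬b with ¬∀⟶∃¬ n _ (λ v → 2 * hurt s v ≤? limit s v) ¬b
    ...   | v , ¬le = inj₂ (toggle v s , ≤-linear 0 (≰⇒> ¬le)
              (trans (lemma (Φ (toggle v s)) (2 * hurt s v)) (trans (cong suc (Φ-toggle s v)) (sym (+-suc (Φ s) _)))))
      where
      lemma : ∀ a b → suc a + b + 0 ≡ suc (a + b)
      lemma = solve-∀

  TiedTo : (Fin n → Bool) → Fin n → Chain n → Set
  TiedTo T v e = tie e ≡ true × ((src e ≡ v × T (tgt e) ≡ true) ⊎ (tgt e ≡ v × T (src e) ≡ true))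

  tiedTo? : ∀ T v e → Dec (TiedTo T v e)
  tiedTo? T v e = (tie e Bool.≟ true) ×-dec
    (((src e ≟ v) ×-dec (T (tgt e) Bool.≟ true)) ⊎-dec ((tgt e ≟ v) ×-dec (T (src e) Bool.≟ true)))

  -- An independent set of bare vertices in the graph of ties. Maximality is claimed only for the
  -- vertices `ws` treated so far, which makes the greedy choice an induction.
  record Selection (T : Fin n → Bool) (ws : List (Fin n)) : Set where
    field
      chosen-bare : ∀ {v} → T v ≡ true → bare v ≡ true
      independent : ∀ {e} → e ∈ Cs → tie e ≡ true → T (src e) ∧ T (tgt e) ≡ false
      maximal     : ∀ {v} → v ∈ ws → bare v ≡ true → T v ≡ true ⊎ ∃ λ e → e ∈ Cs × TiedTo T v e

  open Selection

  select : ∀ ws → ∃ λ T → Selection T ws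
  select [] = (λ _ → false) , record { chosen-bare = λ () ; independent = λ _ _ → refl ; maximal = λ () }
  select (w ∷ ws) with select ws
  ... | T , S with bare w in bw | any? (tiedTo? T w) Cs
  ...   | false | _ = T , record { chosen-bare = chosen-bare S ; independent = independent S ; maximal = λ
            { (here refl) b → ⊥-elim (false≢true (trans (sym bw) b)) ; (there m) → maximal S m } }
    where
    false≢true : false ≢ true
    false≢true ()
  ...   | true | yes a = T , record { chosen-bare = chosen-bare S ; independent = independent S ; maximal = λ { (here refl) _ → inj₂ (find a) ; (there m) → maximal S m } }
  ...   | true | no ¬a = T′ , record
      { chosen-bare = chosen′
      ; independent = independent′
      ; maximal     = λ { (here refl) _ → inj₁ (cong (_∨ T w) (dec-true (w ≟ w) refl)) ; (there m) b → up (maximal S m b) }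
      }
    where
    T′ : Fin n → Bool
    T′ v = does (w ≟ v) ∨ T v
    ⊆T′ : ∀ {v} → T v ≡ true → T′ v ≡ true
    ⊆T′ {v} t = trans (cong (does (w ≟ v) ∨_) t) (Bool.∨-zeroʳ _)
    chosen′ : ∀ {v} → T′ v ≡ true → bare v ≡ true
    chosen′ {v} t with w ≟ v
    ... | yes refl = bw
    ... | no _     = chosen-bare S t
    up : ∀ {v} → T v ≡ true ⊎ (∃ λ e → e ∈ Cs × TiedTo T v e) → T′ v ≡ true ⊎ (∃ λ e → e ∈ Cs × TiedTo T′ v e)
    up (inj₁ t) = inj₁ (⊆T′ t)
    up (inj₂ (e , m , te , inj₁ (eq , t))) = inj₂ (e , m , te , inj₁ (eq , ⊆T′ t))
    up (inj₂ (e , m , te , inj₂ (eq , t))) = inj₂ (e , m , te , inj₂ (eq , ⊆T′ t))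
    independent′ : ∀ {e} → e ∈ Cs → tie e ≡ true → T′ (src e) ∧ T′ (tgt e) ≡ false
    independent′ {e} m te with w ≟ src e | w ≟ tgt e
    ... | no _ | no _ = independent S m te
    ... | yes refl | yes eq = ⊥-elim (loop-not-tie (trans (sym te) (cong (λ d → not d ∧ is-r₁ (ρ e)) (dec-true (src e ≟ tgt e) eq))))
      where
      loop-not-tie : true ≢ false
      loop-not-tie ()
    ... | yes refl | no _ with T (tgt e) in t
    ...   | true  = ⊥-elim (¬a (lose m (te , inj₁ (refl , t))))
    ...   | false = refl
    independent′ {e} m te | no _ | yes refl with T (src e) in t
    ...   | true  = ⊥-elim (¬a (lose m (te , inj₂ (refl , t))))
    ...   | false = refl

inc-cases : ∀ {n} (v : Fin n) e → v ≡ Chain.src e ⊎ v ≡ Chain.tgt e ⊎ inc v e ≡ 0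
inc-cases v (chain x p y) with v ≟ x | v ≟ y
... | yes eq | _      = inj₁ eq
... | no _   | yes eq = inj₂ (inj₁ eq)
... | no _   | no _   = inj₂ (inj₂ refl)

-- The discharging inequality

record Terminal {n : ℕ} (G : Graph n) (Vs : List (Fin n)) (Cs : List (Chain n)) (Ps : List (Pendant n)) : Set where
  open Chain
  open Discharging G Vs Cs Ps
  field
    inv      : Inv G Vs Cs
    long     : ∀ {e} → e ∈ Cs → mid e ≢ []
    footed   : ∀ {P} → P ∈ Ps → foot P ∈ Vs
    attached : ∀ {P} → P ∈ Ps → Adj G (foot P) (Pendant.x P)
    circuit  : ∀ {y x a b c d} → pendant y x a b c d ∈ Ps → Walk G x (a ∷ b ∷ c ∷ d ∷ []) x
    branch   : ∀ {v} → v ∈ Vs → 3 ≤ deg v Cs + pendants v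

module Discharged {n : ℕ} {G : Graph n} {Vs : List (Fin n)} {Cs : List (Chain n)} {Ps : List (Pendant n)}
                  (terminal : Terminal G Vs Cs Ps)
                  {s : Fin n → Bool} (balance : Discharging.Balanced G Vs Cs Ps s)
                  {T : Fin n → Bool} (selection : Discharging.Selection G Vs Cs Ps T Vs) where
  open Chain
  open Discharging G Vs Cs Ps
  open Terminal terminal
  open Selection selection

  2deg≤ : ∀ v → 2 * deg v Cs ≤ ⅀ (λ e → inc v e * h e) Cs
  2deg≤ v = ≤-trans (≤-reflexive (sym (⅀-* 2 (inc v) Cs)))
    (⅀-mono Cs (λ {e} _ → ≤-trans (≤-reflexive (*-comm 2 (inc v e))) (*-monoʳ-≤ (inc v e) (2≤half (ρ e)))))

  2deg≤income : ∀ v → 2 * (deg v Cs + pendants v) ≤ income v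
  2deg≤income v = ≤-trans (≤-reflexive (*-distribˡ-+ 2 (deg v Cs) _)) (+-monoˡ-≤ (2 * pendants v) (2deg≤ v))

  6≤income : ∀ {v} → v ∈ Vs → 6 ≤ income v
  6≤income {v} m = ≤-trans (*-monoʳ-≤ 2 (branch m)) (2deg≤income v)

  -- Each of the at least three places at `v` pays 2 or more, and one of them pays `c` beyond that.
  surplus : ∀ {v e} c → v ∈ Vs → e ∈ Cs → 1 ≤ inc v e → 2 + c ≤ h e → 6 + c ≤ income v
  surplus {v} {e} c vm em 1≤ le = ≤-trans (+-monoˡ-≤ c (*-monoʳ-≤ 2 (branch vm)))
    (≤-trans (≤-reflexive (lemma (deg v Cs) (pendants v) c)) (+-monoˡ-≤ (2 * pendants v)
      (≤-trans (≤-reflexive (cong (_+ c) (sym (⅀-* 2 (inc v) Cs))))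
        (⅀-mono-at c Cs (λ {f} _ → ≤-trans (≤-reflexive (*-comm 2 (inc v f))) (*-monoʳ-≤ (inc v f) (2≤half (ρ f))))
          em (at (inc v e) 1≤)))))
    where
    lemma : ∀ d p c → 2 * (d + p) + c ≡ 2 * d + c + 2 * p
    lemma = solve-∀
    lemma′ : ∀ k c → 2 * k + k * c ≡ k * (2 + c)
    lemma′ = solve-∀
    at : ∀ k → 1 ≤ k → 2 * k + c ≤ k * h e
    at (suc k) _ = ≤-trans (+-monoʳ-≤ (2 * suc k) (m≤m+n c _))
      (≤-trans (≤-reflexive (lemma′ (suc k) c)) (*-monoʳ-≤ (suc k) le))

  true≢false : true ≢ false
  true≢false ()

  does-true : ∀ {a b} → does (a ≤? b) ≡ true → a ≤ b
  does-true {a} {b} eq = ≤ᵇ⇒≤ a b (subst Bool.T (sym eq) tt)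

  poor⇒ : ∀ v → poor v ≡ true → income v ≤ 7
  poor⇒ v eq = does-true {income v} eq

  ∧-true : ∀ {a b} → a ∧ b ≡ true → a ≡ true × b ≡ true
  ∧-true {true} {true} _ = refl , refl

  bare⇒ : ∀ v → bare v ≡ true → income v ≤ 6 × 2 ≤ ties v
  bare⇒ v eq = let a , b = ∧-true eq in does-true {income v} a , does-true {2} b

  poor-r₂ : ∀ {v e} → v ∈ Vs → e ∈ Cs → 1 ≤ inc v e → ρ e ≡ r₂ → poor v ≡ false
  poor-r₂ {v} {e} vm em 1≤ eq = dec-false (income v ≤? 7)
    (λ le → 1+n≰n (≤-trans (surplus 2 vm em 1≤ (subst (λ r → 4 ≤ half r) (sym eq) ≤-refl)) le))

  lean-r₁ : ∀ {v e} → v ∈ Vs → e ∈ Cs → 1 ≤ inc v e → income v ≤ 6 → ρ e ≡ r₁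
  lean-r₁ {v} {e} vm em 1≤ le with ρ e in eq
  ... | r₁ = refl
  ... | r₀ = ⊥-elim (1+n≰n (≤-trans (surplus 1 vm em 1≤ (subst (λ r → 3 ≤ half r) (sym eq) ≤-refl)) le))
  ... | r₂ = ⊥-elim (1+n≰n (≤-trans (surplus 1 vm em 1≤ (subst (λ r → 3 ≤ half r) (sym eq) (n≤1+n 3))) le))

  b2n≤1 : ∀ b → b2n b ≤ 1
  b2n≤1 true  = ≤-refl
  b2n≤1 false = z≤n

  *b2n≤ : ∀ k b → k * b2n b ≤ k
  *b2n≤ k b = ≤-trans (*-monoʳ-≤ k (b2n≤1 b)) (≤-reflexive (*-identityʳ k))

  deg≤3 : ∀ {v} → income v ≤ 7 → deg v Cs + pendants v ≤ 3
  deg≤3 {v} le = ≤-pred (*-cancelˡ-< 2 _ 4 (s≤s (≤-trans (2deg≤income v) le)))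

  -- A loop fills two of the three places at `v` and is not a tie, so two ties do not fit beside it.
  bare-loop : ∀ {v e} → v ∈ Vs → e ∈ Cs → src e ≡ v → tgt e ≡ v → bare v ≡ true → ⊥
  bare-loop {v} {e} vm em refl eq b = 1+n≰n (≤-trans (≤-trans (+-monoˡ-≤ 2 2≤ties)
      (⅀-mono-at 2 Cs (λ {f} _ → *b2n≤ (inc v f) (tie f)) em at))
      (≤-trans (m≤m+n (deg v Cs) (pendants v)) (deg≤3 {v} (≤-trans lean (n≤1+n 6)))))
    where
    lean = proj₁ (bare⇒ v b)
    2≤ties = proj₂ (bare⇒ v b)
    at : inc v e * b2n (tie e) + 2 ≤ inc v e
    at rewrite eq | dec-true (v ≟ v) refl = ≤-refl

  chosen-lean : ∀ v → T v ≡ true → income v ≤ 6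
  chosen-lean v t = proj₁ (bare⇒ v (chosen-bare t))

  chosen-poor : ∀ v → T v ≡ true → poor v ≡ true
  chosen-poor v t = dec-true (income v ≤? 7) (≤-trans (chosen-lean v t) (n≤1+n 6))

  hurt : Fin n → ℕ
  hurt v = ⅀ (λ e → inc v e * penalty s e) Cs

  hurt-rich : ∀ v → poor v ≡ false → hurt v ≡ 0
  hurt-rich v pf = n≤0⇒n≡0 (≤-trans (⅀-mono Cs (λ {e} _ → bound e)) (≤-reflexive (⅀-zero Cs)))
    where
    source : ∀ a b c d → b ≡ false → b2n (a ∧ b ∧ c ∧ d) ≡ 0
    source true  b c d refl = refl
    source false b c d refl = refl
    target : ∀ a b c d → c ≡ false → b2n (a ∧ b ∧ c ∧ d) ≡ 0
    target true  true  c d refl = refl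
    target true  false c d refl = refl
    target false b     c d refl = refl
    bound : ∀ e → inc v e * penalty s e ≤ 0
    bound e with inc-cases v e
    ... | inj₁ eq        = ≤-reflexive (trans (cong (inc v e *_)
            (source (straight e) (poor (src e)) (poor (tgt e)) _ (subst (λ w → poor w ≡ false) eq pf))) (*-zeroʳ (inc v e)))
    ... | inj₂ (inj₁ eq) = ≤-reflexive (trans (cong (inc v e *_)
            (target (straight e) (poor (src e)) (poor (tgt e)) _ (subst (λ w → poor w ≡ false) eq pf))) (*-zeroʳ (inc v e)))
    ... | inj₂ (inj₂ eq) = ≤-reflexive (cong (_* penalty s e) eq)

  -- There are at most three constraints at `v`; half of three rounds down to 1.
  hurt-poor : ∀ {v} → income v ≤ 7 → hurt v ≤ 1
  hurt-poor {v} le = ≤-pred (*-cancelˡ-< 2 _ 2 (s≤s (≤-trans (balance v)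
    (≤-trans (⅀-mono Cs (λ {e} _ → *b2n≤ (inc v e) _)) (≤-trans (m≤m+n _ (pendants v)) (deg≤3 {v} le))))))

  -- At income 6 all chains have residue 1, so a constraint is a tie. This is proved in summed form:
  -- `table` gives `constraint + 2 ≤ tie + h` on each chain, and three places already use up the
  -- income.
  constraints≤ties : ∀ {v} → v ∈ Vs → income v ≤ 6 → ⅀ (λ e → inc v e * constraint e) Cs ≤ ties v
  constraints≤ties {v} vm le = ≤-linear 0
    (+-mono-≤ (+-mono-≤ edges (*-monoʳ-≤ 2 (branch vm))) le)
    (lemma (⅀ (λ e → inc v e * constraint e) Cs) (ties v) (⅀ (λ e → inc v e * h e) Cs) (pendants v) (deg v Cs))
    where
    lemma : ∀ c t i p d → c + (t + i + 2 * (d + p) + 6) + 0 ≡ t + (c + 2 * d + 2 * 3 + (i + 2 * p))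
    lemma = solve-∀
    table : ∀ q a b r → b2n (q ∧ a ∧ b ∧ proper r) + 2 ≤ b2n (q ∧ is-r₁ r) + half r
    table false a b r = 2≤half r
    table true false b r = ≤-trans (2≤half r) (m≤n+m _ _)
    table true true false r = ≤-trans (2≤half r) (m≤n+m _ _)
    table true true true r₀ = ≤-refl
    table true true true r₁ = ≤-refl
    table true true true r₂ = s≤s (s≤s z≤n)
    edges : ⅀ (λ e → inc v e * constraint e) Cs + 2 * deg v Cs ≤ ties v + ⅀ (λ e → inc v e * h e) Cs
    edges = begin
      ⅀ (λ e → inc v e * constraint e) Cs + 2 * deg v Cs
        ≡⟨ cong (⅀ (λ e → inc v e * constraint e) Cs +_) (⅀-* 2 (inc v) Cs) ⟨
      ⅀ (λ e → inc v e * constraint e) Cs + ⅀ (λ e → 2 * inc v e) Cs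
        ≡⟨ ⅀-+ _ _ Cs ⟨
      ⅀ (λ e → inc v e * constraint e + 2 * inc v e) Cs
        ≤⟨ ⅀-mono Cs (λ {e} _ → edge e) ⟩
      ⅀ (λ e → inc v e * b2n (tie e) + inc v e * h e) Cs
        ≡⟨ ⅀-+ _ _ Cs ⟩
      ties v + ⅀ (λ e → inc v e * h e) Cs ∎
      where
      open ≤-Reasoning
      edge : ∀ e → inc v e * constraint e + 2 * inc v e ≤ inc v e * b2n (tie e) + inc v e * h e
      edge e = begin
        inc v e * constraint e + 2 * inc v e    ≡⟨ cong (inc v e * constraint e +_) (*-comm 2 (inc v e)) ⟩
        inc v e * constraint e + inc v e * 2    ≡⟨ *-distribˡ-+ (inc v e) (constraint e) 2 ⟨
        inc v e * (constraint e + 2)            ≤⟨ *-monoʳ-≤ (inc v e) (table (straight e) (poor (src e)) (poor (tgt e)) (ρ e)) ⟩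
        inc v e * (b2n (tie e) + h e)           ≡⟨ *-distribˡ-+ (inc v e) (b2n (tie e)) (h e) ⟩
        inc v e * b2n (tie e) + inc v e * h e   ∎

  hurt-lean : ∀ {v} → v ∈ Vs → income v ≤ 6 → ¬ 2 ≤ ties v → hurt v ≡ 0
  hurt-lean {v} vm le ¬2 = n≤0⇒n≡0 (≤-pred (*-cancelˡ-< 2 _ 1
    (≤-trans (s≤s (≤-trans (balance v) (constraints≤ties vm le))) (≰⇒> ¬2))))

  -- Payments of 1 sixth that reach `v` along ties to selected vertices; parallel ties pay
  -- separately.
  received : Fin n → ℕ
  received v = ⅀ (λ e → b2n (tie e) * (δ v (src e) * b2n (T (tgt e)) + δ v (tgt e) * b2n (T (src e)))) Cs

  1≤received : ∀ {v e} → e ∈ Cs → TiedTo T v e → 1 ≤ received v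
  1≤received {v} {e} em (te , c) = ≤-trans (term c)
    (∈⇒≤⅀ (λ e → b2n (tie e) * (δ v (src e) * b2n (T (tgt e)) + δ v (tgt e) * b2n (T (src e)))) em)
    where
    term : (src e ≡ v × T (tgt e) ≡ true) ⊎ (tgt e ≡ v × T (src e) ≡ true) →
           1 ≤ b2n (tie e) * (δ v (src e) * b2n (T (tgt e)) + δ v (tgt e) * b2n (T (src e)))
    term (inj₁ (refl , t)) rewrite te | t | δ-refl v = s≤s z≤n
    term (inj₂ (refl , t)) rewrite te | t | δ-refl v = ≤-trans (m≤n+m 1 (δ v (src e) * b2n (T (tgt e)))) (m≤m+n _ 0)

  -- In sixths, so that a conflict can be halved: the need is 16, each conflict charges 3 at each
  -- end, a withdrawn colour and a withdrawn 2 save 6 each, and a selected vertex gives 3 away. The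
  -- last case is exact: 19 = 12 + 6 + 1.
  balance-table : ∀ t p i k r → 6 ≤ i → (p ≡ false → k ≡ 0 × 8 ≤ i) → (p ≡ true → k ≤ 1) → (t ≡ true → p ≡ true) →
    (p ≡ true → t ≡ false → 7 ≤ i ⊎ k ≡ 0 ⊎ 1 ≤ r) →
    16 + 3 * k + 3 * b2n t ≤ 2 * i + 6 * b2n p + 6 * b2n t + r
  balance-table true false i k r 6≤ rich poor′ t⇒p rest with t⇒p refl
  ... | ()
  balance-table true true i k r 6≤ rich poor′ t⇒p rest = ≤-trans (+-monoˡ-≤ 3 (+-monoʳ-≤ 16 (*-monoʳ-≤ 3 (poor′ refl))))
    (≤-trans (m≤m+n 22 2) (≤-trans (+-monoˡ-≤ 6 (+-monoˡ-≤ 6 (*-monoʳ-≤ 2 6≤))) (m≤m+n _ r)))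
  balance-table false false i k r 6≤ rich poor′ t⇒p rest with rich refl
  ... | refl , 8≤ = ≤-trans (*-monoʳ-≤ 2 8≤) (≤-trans (m≤m+n _ 0) (≤-trans (m≤m+n _ 0) (m≤m+n _ r)))
  balance-table false true i k r 6≤ rich poor′ t⇒p rest with rest refl refl
  ... | inj₁ 7≤ = ≤-trans (+-monoˡ-≤ 0 (+-monoʳ-≤ 16 (*-monoʳ-≤ 3 (poor′ refl))))
    (≤-trans (m≤m+n 19 1) (≤-trans (+-monoˡ-≤ 0 (+-monoˡ-≤ 6 (*-monoʳ-≤ 2 7≤))) (m≤m+n _ r)))
  ... | inj₂ (inj₁ refl) = ≤-trans (m≤m+n 16 2) (≤-trans (+-monoˡ-≤ 0 (+-monoˡ-≤ 6 (*-monoʳ-≤ 2 6≤))) (m≤m+n _ r))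
  ... | inj₂ (inj₂ 1≤r) = ≤-trans (+-monoˡ-≤ 0 (+-monoʳ-≤ 16 (*-monoʳ-≤ 3 (poor′ refl))))
    (+-mono-≤ (+-monoˡ-≤ 0 (+-monoˡ-≤ 6 (*-monoʳ-≤ 2 6≤))) 1≤r)

  -- A selected vertex pays 1 along each of its three ties.
  vertex-balance : ∀ {v} → v ∈ Vs →
    16 + 3 * hurt v + 3 * b2n (T v) ≤ 2 * income v + 6 * b2n (poor v) + 6 * b2n (T v) + received v
  vertex-balance {v} vm = balance-table (T v) (poor v) (income v) (hurt v) (received v) (6≤income vm)
    (λ p → hurt-rich v p , ≰⇒> (λ le → true≢false (trans (sym (dec-true (income v ≤? 7) le)) p)))
    (λ p → hurt-poor {v} (poor⇒ v p)) (chosen-poor v) rest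
    where
    rest : poor v ≡ true → T v ≡ false → 7 ≤ income v ⊎ hurt v ≡ 0 ⊎ 1 ≤ received v
    rest p t with income v ≤? 6
    ... | no ¬le = inj₁ (≰⇒> ¬le)
    ... | yes le with 2 ≤? ties v
    ...   | no ¬2 = inj₂ (inj₁ (hurt-lean vm le ¬2))
    ...   | yes 2≤ with maximal vm (cong₂ _∧_ (dec-true (income v ≤? 6) le) (dec-true (2 ≤? ties v) 2≤))
    ...     | inj₁ t′ = ⊥-elim (true≢false (trans (sym t′) t))
    ...     | inj₂ (e , em , td) = inj₂ (inj₂ (1≤received em td))

  module _ where
    open ≡-Reasoning

    ⅀-inc : ∀ (g : Fin n → ℕ) {e} → e ∈ Cs → ⅀ (λ v → inc v e * g v) Vs ≡ g (src e) + g (tgt e)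
    ⅀-inc g {e} em = begin
      ⅀ (λ v → inc v e * g v) Vs
        ≡⟨ ⅀-cong Vs (λ {v} _ → *-distribʳ-+ (g v) (δ v (src e)) (δ v (tgt e))) ⟩
      ⅀ (λ v → δ v (src e) * g v + δ v (tgt e) * g v) Vs
        ≡⟨ ⅀-+ (λ v → δ v (src e) * g v) (λ v → δ v (tgt e) * g v) Vs ⟩
      ⅀ (λ v → δ v (src e) * g v) Vs + ⅀ (λ v → δ v (tgt e) * g v) Vs
        ≡⟨ cong₂ _+_ (⅀-δ g Vs (uniq inv) (proj₁ (ends inv em))) (⅀-δ g Vs (uniq inv) (proj₂ (ends inv em))) ⟩
      g (src e) + g (tgt e) ∎

    handshake : ∀ (k : Chain n → ℕ) → ⅀ (λ v → ⅀ (λ e → inc v e * k e) Cs) Vs ≡ 2 * ⅀ k Cs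
    handshake k = begin
      ⅀ (λ v → ⅀ (λ e → inc v e * k e) Cs) Vs ≡⟨ ⅀-swap (λ v e → inc v e * k e) Vs Cs ⟩
      ⅀ (λ e → ⅀ (λ v → inc v e * k e) Vs) Cs ≡⟨ ⅀-cong Cs (λ {e} em → trans (⅀-inc (λ _ → k e) em) (lemma (k e))) ⟩
      ⅀ (λ e → 2 * k e) Cs                    ≡⟨ ⅀-* 2 k Cs ⟩
      2 * ⅀ k Cs                              ∎
      where
      lemma : ∀ a → a + a ≡ 2 * a
      lemma = solve-∀

    pendant-count : ∀ (g : Fin n → ℕ) → ⅀ (λ v → g v * pendants v) Vs ≡ ⅀ (λ P → g (foot P)) Ps
    pendant-count g = begin
      ⅀ (λ v → g v * pendants v) Vs
        ≡⟨ ⅀-cong Vs (λ {v} _ → sym (⅀-* (g v) (λ P → δ v (foot P)) Ps)) ⟩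
      ⅀ (λ v → ⅀ (λ P → g v * δ v (foot P)) Ps) Vs
        ≡⟨ ⅀-swap (λ v P → g v * δ v (foot P)) Vs Ps ⟩
      ⅀ (λ P → ⅀ (λ v → g v * δ v (foot P)) Vs) Ps
        ≡⟨ ⅀-cong Ps (λ {P} pm → trans (⅀-cong Vs (λ {v} _ → *-comm (g v) (δ v (foot P))))
                                   (⅀-δ g Vs (uniq inv) (footed pm))) ⟩
      ⅀ (λ P → g (foot P)) Ps ∎

    total-income : ⅀ income Vs ≡ 2 * ⅀ h Cs + 2 * length Ps
    total-income = begin
      ⅀ income Vs
        ≡⟨ ⅀-+ (λ v → ⅀ (λ e → inc v e * h e) Cs) (λ v → 2 * pendants v) Vs ⟩
      ⅀ (λ v → ⅀ (λ e → inc v e * h e) Cs) Vs + ⅀ (λ v → 2 * pendants v) Vs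
        ≡⟨ cong₂ _+_ (handshake h) (trans (pendant-count (λ _ → 2)) (⅀-const 2 Ps)) ⟩
      2 * ⅀ h Cs + 2 * length Ps ∎

    -- Double counting of the payments, by receiver on the left and by payer on the right.
    total-received : ⅀ received Vs ≡ ⅀ (λ v → b2n (T v) * ties v) Vs
    total-received = begin
      ⅀ received Vs
        ≡⟨ ⅀-swap (λ v e → b2n (tie e) * pay v e) Vs Cs ⟩
      ⅀ (λ e → ⅀ (λ v → b2n (tie e) * pay v e) Vs) Cs
        ≡⟨ ⅀-cong Cs (λ {e} em → trans (⅀-* (b2n (tie e)) (λ v → pay v e) Vs) (cong (b2n (tie e) *_) (paid em))) ⟩
      ⅀ (λ e → b2n (tie e) * (b2n (T (src e)) + b2n (T (tgt e)))) Cs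
        ≡⟨ ⅀-cong Cs (λ {e} em → cong (b2n (tie e) *_) (sym (⅀-inc (λ v → b2n (T v)) em))) ⟩
      ⅀ (λ e → b2n (tie e) * ⅀ (λ v → inc v e * b2n (T v)) Vs) Cs
        ≡⟨ ⅀-cong Cs (λ {e} em → sym (⅀-* (b2n (tie e)) (λ v → inc v e * b2n (T v)) Vs)) ⟩
      ⅀ (λ e → ⅀ (λ v → b2n (tie e) * (inc v e * b2n (T v))) Vs) Cs
        ≡⟨ ⅀-swap (λ e v → b2n (tie e) * (inc v e * b2n (T v))) Cs Vs ⟩
      ⅀ (λ v → ⅀ (λ e → b2n (tie e) * (inc v e * b2n (T v))) Cs) Vs
        ≡⟨ ⅀-cong Vs (λ {v} _ → trans (⅀-cong Cs (λ {e} _ → lemma (b2n (tie e)) (inc v e) (b2n (T v))))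
                                        (⅀-* (b2n (T v)) (λ e → inc v e * b2n (tie e)) Cs)) ⟩
      ⅀ (λ v → b2n (T v) * ties v) Vs ∎
      where
      lemma : ∀ a b c → a * (b * c) ≡ c * (b * a)
      lemma = solve-∀
      pay : Fin n → Chain n → ℕ
      pay v e = δ v (src e) * b2n (T (tgt e)) + δ v (tgt e) * b2n (T (src e))
      paid : ∀ {e} → e ∈ Cs → ⅀ (λ v → pay v e) Vs ≡ b2n (T (src e)) + b2n (T (tgt e))
      paid {e} em = begin
        ⅀ (λ v → pay v e) Vs
          ≡⟨ ⅀-+ (λ v → δ v (src e) * b2n (T (tgt e))) (λ v → δ v (tgt e) * b2n (T (src e))) Vs ⟩
        ⅀ (λ v → δ v (src e) * b2n (T (tgt e))) Vs + ⅀ (λ v → δ v (tgt e) * b2n (T (src e))) Vs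
          ≡⟨ cong₂ _+_ (⅀-δ (λ _ → b2n (T (tgt e))) Vs (uniq inv) (proj₁ (ends inv em)))
                       (⅀-δ (λ _ → b2n (T (src e))) Vs (uniq inv) (proj₂ (ends inv em))) ⟩
        b2n (T (tgt e)) + b2n (T (src e))
          ≡⟨ +-comm (b2n (T (tgt e))) _ ⟩
        b2n (T (src e)) + b2n (T (tgt e)) ∎

  ties≤deg : ∀ v → ties v ≤ deg v Cs
  ties≤deg v = ⅀-mono Cs (λ {e} _ → *b2n≤ (inc v e) (tie e))

  chosen-deg : ∀ v → T v ≡ true → deg v Cs + pendants v ≤ 3
  chosen-deg v t = deg≤3 {v} (≤-trans (chosen-lean v t) (n≤1+n 6))

  chosen-ties : ∀ v → b2n (T v) * ties v ≤ 3 * b2n (T v)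
  chosen-ties v with T v in t
  ... | false = z≤n
  ... | true  = ≤-trans (≤-reflexive (*-identityˡ (ties v)))
    (≤-trans (ties≤deg v) (≤-trans (m≤m+n (deg v Cs) (pendants v)) (chosen-deg v t)))

  -- Two of the three places are ties. A second pendant would spoil the gain, since each pendant at
  -- a selected foot costs 1 more.
  chosen-pendants : ∀ v → T v ≡ true → pendants v ≤ 1
  chosen-pendants v t = +-cancelˡ-≤ 2 _ _ (≤-trans
    (+-monoˡ-≤ (pendants v) (≤-trans (proj₂ (bare⇒ v (chosen-bare t))) (ties≤deg v))) (chosen-deg v t))

  -- Sums `vertex-balance` and halves it. What is received is at most 3 per selected vertex, so it
  -- cancels against the 3 given away.
  total : 8 * length Vs + 3 * ⅀ (penalty s) Cs ≤ ⅀ income Vs + 3 * ⅀ (λ v → b2n (poor v)) Vs + 3 * ⅀ (λ v → b2n (T v)) Vs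
  total = *-cancelˡ-≤ 2 (≤-linear 0 (+-mono-≤ vertices received≤)
    (lemma (length Vs) (⅀ (penalty s) Cs) (⅀ income Vs) (⅀ (λ v → b2n (poor v)) Vs) (⅀ (λ v → b2n (T v)) Vs) (⅀ received Vs)))
    where
    lemma : ∀ l u i p t r →
      2 * (8 * l + 3 * u) + (2 * i + 6 * p + 6 * t + r + 3 * t) + 0 ≡
      2 * (i + 3 * p + 3 * t) + (16 * l + 3 * (2 * u) + 3 * t + r)
    lemma = solve-∀
    received≤ : ⅀ received Vs ≤ 3 * ⅀ (λ v → b2n (T v)) Vs
    received≤ = ≤-trans (≤-reflexive total-received) (≤-trans (⅀-mono Vs (λ {v} _ → chosen-ties v))
      (≤-reflexive (⅀-* 3 (λ v → b2n (T v)) Vs)))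
    open ≤-Reasoning
    vertices : 16 * length Vs + 3 * (2 * ⅀ (penalty s) Cs) + 3 * ⅀ (λ v → b2n (T v)) Vs ≤
               2 * ⅀ income Vs + 6 * ⅀ (λ v → b2n (poor v)) Vs + 6 * ⅀ (λ v → b2n (T v)) Vs + ⅀ received Vs
    vertices = begin
      16 * length Vs + 3 * (2 * ⅀ (penalty s) Cs) + 3 * ⅀ (λ v → b2n (T v)) Vs
        ≡⟨ cong₂ _+_ (cong₂ _+_ (⅀-const 16 Vs) (trans (⅀-* 3 hurt Vs) (cong (3 *_) (handshake (penalty s)))))
                     (⅀-* 3 (λ v → b2n (T v)) Vs) ⟨
      ⅀ (λ _ → 16) Vs + ⅀ (λ v → 3 * hurt v) Vs + ⅀ (λ v → 3 * b2n (T v)) Vs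
        ≡⟨ cong (_+ ⅀ (λ v → 3 * b2n (T v)) Vs) (⅀-+ (λ _ → 16) (λ v → 3 * hurt v) Vs) ⟨
      ⅀ (λ v → 16 + 3 * hurt v) Vs + ⅀ (λ v → 3 * b2n (T v)) Vs
        ≡⟨ ⅀-+ (λ v → 16 + 3 * hurt v) (λ v → 3 * b2n (T v)) Vs ⟨
      ⅀ (λ v → 16 + 3 * hurt v + 3 * b2n (T v)) Vs
        ≤⟨ ⅀-mono Vs (λ {v} vm → vertex-balance vm) ⟩
      ⅀ (λ v → 2 * income v + 6 * b2n (poor v) + 6 * b2n (T v) + received v) Vs
        ≡⟨ ⅀-+ (λ v → 2 * income v + 6 * b2n (poor v) + 6 * b2n (T v)) received Vs ⟩
      ⅀ (λ v → 2 * income v + 6 * b2n (poor v) + 6 * b2n (T v)) Vs + ⅀ received Vs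
        ≡⟨ cong (_+ ⅀ received Vs) (⅀-+ (λ v → 2 * income v + 6 * b2n (poor v)) (λ v → 6 * b2n (T v)) Vs) ⟩
      ⅀ (λ v → 2 * income v + 6 * b2n (poor v)) Vs + ⅀ (λ v → 6 * b2n (T v)) Vs + ⅀ received Vs
        ≡⟨ cong (λ k → k + ⅀ (λ v → 6 * b2n (T v)) Vs + ⅀ received Vs) (⅀-+ (λ v → 2 * income v) (λ v → 6 * b2n (poor v)) Vs) ⟩
      ⅀ (λ v → 2 * income v) Vs + ⅀ (λ v → 6 * b2n (poor v)) Vs + ⅀ (λ v → 6 * b2n (T v)) Vs + ⅀ received Vs
        ≡⟨ cong (_+ ⅀ received Vs) (cong₂ _+_ (cong₂ _+_ (⅀-* 2 income Vs) (⅀-* 6 (λ v → b2n (poor v)) Vs))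
                                              (⅀-* 6 (λ v → b2n (T v)) Vs)) ⟩
      2 * ⅀ income Vs + 6 * ⅀ (λ v → b2n (poor v)) Vs + 6 * ⅀ (λ v → b2n (T v)) Vs + ⅀ received Vs ∎

  -- Assembling the two labellings

  rainbow-label : Fin n → Label2
  rainbow-label v = colour (poor v) (s v)

  -- A selected vertex with a pendant is dominated from it and can take 0; without one it keeps 1 to
  -- satisfy itself.
  romanOf : Bool → ℕ → Fin 3
  romanOf false _       = 2F
  romanOf true  zero    = 1F
  romanOf true  (suc _) = 0F

  roman-label : Fin n → Fin 3
  roman-label v = romanOf (T v) (pendants v)

  colour-weight : ∀ a t → Rule.wt rainbow (colour a t) + b2n a ≡ 2
  colour-weight false _     = refl
  colour-weight true  true  = refl
  colour-weight true  false = refl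

  -- Selection saves 1 either way: the label drops from 2 to 1, or from 2 to 0 while the pendant
  -- becomes dearer by 1, which is the term `b2n t * k`.
  roman-weight : ∀ t k → (t ≡ true → k ≤ 1) → toℕ (romanOf t k) + b2n t + b2n t * k ≤ 2
  roman-weight false k h = ≤-refl
  roman-weight true zero h = ≤-refl
  roman-weight true (suc k) h with k | h refl
  ... | zero | _ = ≤-refl
  ... | suc _ | s≤s ()

  long-suc : ∀ {e} → e ∈ Cs → ∃ λ k → length (mid e) ≡ suc k
  long-suc {chain _ [] _}      em = ⊥-elim (long em refl)
  long-suc {chain _ (_ ∷ p) _} em = length p , refl

  1≤inc-src : (e : Chain n) → 1 ≤ inc (src e) e
  1≤inc-src e = ≤-trans (≤-reflexive (sym (δ-refl (src e)))) (m≤m+n _ _)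

  1≤inc-tgt : (e : Chain n) → 1 ≤ inc (tgt e) e
  1≤inc-tgt e = ≤-trans (≤-reflexive (sym (δ-refl (tgt e)))) (m≤n+m _ (δ (tgt e) (src e)))

  chain-rainbow : ∀ {e} → e ∈ Cs →
    Rb.Block G (Rb.labelWith G rainbow-label Vs) (mid e) (base (length (mid e)) + penalty s e)
  chain-rainbow {e} em with long-suc em
  ... | k , eq = subst (λ m → Rb.Block G (Rb.labelWith G rainbow-label Vs) (mid e) (base m + penalty s e)) (sym eq) (use pat)
    where
    source = ends inv em
    stands : ∀ {v} → v ∈ Vs → Rb.Stands G (Rb.labelWith G rainbow-label Vs) v (colour (poor v) (s v))
    stands {v} vm c hc = rainbow-label v , Rb.∈-labelWith G rainbow-label vm , hc
    ρ≡ : ρ e ≡ res (suc k)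
    ρ≡ = cong res eq
    pen : Chain n → Res → ℕ
    pen e r = b2n (straight e ∧ poor (src e) ∧ poor (tgt e) ∧ conflict r (s (src e)) (s (tgt e)))
    Goal : ℕ → Set
    Goal c = Pattern rainbow (colour (poor (src e)) (s (src e))) (colour (poor (tgt e)) (s (tgt e))) (suc k) c
    use : Goal (base (suc k) + pen e (res (suc k))) →
          Rb.Block G (Rb.labelWith G rainbow-label Vs) (mid e) (base (suc k) + penalty s e)
    use (mkPattern ws len fits cost) = Rb.chain-block G ws (walk inv em) (trans len (sym eq)) fits
      (≤-trans cost (≤-reflexive (cong (λ r → base (suc k) + pen e r) (sym ρ≡))))
      (stands (proj₁ source)) (stands (proj₂ source))
    standard : Goal (base (suc k) + b2n (poor (src e) ∧ poor (tgt e) ∧ conflict (res (suc k)) (s (src e)) (s (tgt e))))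
    standard = rainbow-pattern k (poor (src e)) (s (src e)) (poor (tgt e)) (s (tgt e))
      (λ r → poor-r₂ {src e} (proj₁ source) em (1≤inc-src e) (trans ρ≡ r) , poor-r₂ {tgt e} (proj₂ source) em (1≤inc-tgt e) (trans ρ≡ r))
    loop-pattern : ∀ k → 2 ≤ suc k → ρ e ≡ res (suc k) →
      Pattern rainbow (rainbow-label (src e)) (rainbow-label (src e)) (suc k) (base (suc k))
    loop-pattern zero    (s≤s ()) _
    loop-pattern (suc k) _ r = rainbow-closed k (poor (src e)) (s (src e))
      (λ r′ → poor-r₂ {src e} (proj₁ source) em (1≤inc-src e) (trans r r′))
    pat : Goal (base (suc k) + pen e (res (suc k)))
    pat with src e ≟ tgt e
    ... | no _    = standard
    ... | yes src≡tgt = subst₂ (λ w c → Pattern rainbow (rainbow-label (src e)) (rainbow-label w) (suc k) c)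
      src≡tgt (sym (+-identityʳ (base (suc k)))) (loop-pattern k (subst (2 ≤_) eq (loop inv em src≡tgt)) ρ≡)

  not-true : ∀ {b} → (b ≡ true → ⊥) → b ≡ false
  not-true {true}  ¬t = ⊥-elim (¬t refl)
  not-true {false} _  = refl

  lean⇒¬T : ∀ {v e} → v ∈ Vs → e ∈ Cs → 1 ≤ inc v e → ρ e ≢ r₁ → T v ≡ false
  lean⇒¬T {v} vm em 1≤ ≢r₁ = not-true (λ t → ≢r₁ (lean-r₁ {v} vm em 1≤ (chosen-lean v t)))

  -- A selected vertex has income 6, while an end of residue 0 or 2 would lift it to 7 or more. At
  -- residue 1 independence applies, and loops are excluded by `bare-loop`.
  admissible : ∀ {e} → e ∈ Cs → ∀ r → ρ e ≡ r → Admissible r (T (src e)) (T (tgt e))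
  admissible {e} em r₀ eq =
    lean⇒¬T {src e} (proj₁ (ends inv em)) em (1≤inc-src e) (λ e₁ → r₀≢r₁ (trans (sym eq) e₁)) ,
    lean⇒¬T {tgt e} (proj₂ (ends inv em)) em (1≤inc-tgt e) (λ e₁ → r₀≢r₁ (trans (sym eq) e₁))
    where
    r₀≢r₁ : r₀ ≢ r₁
    r₀≢r₁ ()
  admissible {e} em r₂ eq =
    lean⇒¬T {src e} (proj₁ (ends inv em)) em (1≤inc-src e) (λ e₁ → r₂≢r₁ (trans (sym eq) e₁)) ,
    lean⇒¬T {tgt e} (proj₂ (ends inv em)) em (1≤inc-tgt e) (λ e₁ → r₂≢r₁ (trans (sym eq) e₁))
    where
    r₂≢r₁ : r₂ ≢ r₁
    r₂≢r₁ ()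
  admissible {e} em r₁ eq = by-loop (src e ≟ tgt e)
    where
    by-loop : Dec (src e ≡ tgt e) → T (src e) ∧ T (tgt e) ≡ false
    by-loop (yes l) = cong (_∧ T (tgt e))
      (not-true (λ t → bare-loop {src e} (proj₁ (ends inv em)) em refl (sym l) (chosen-bare t)))
    by-loop (no ¬l) = independent em (cong₂ _∧_ (cong not (dec-false (src e ≟ tgt e) ¬l)) (cong is-r₁ eq))

  chain-roman : ∀ {e} → e ∈ Cs →
    Rm.Block G (Rm.labelWith G roman-label Vs) (mid e) (base (length (mid e)))
  chain-roman {e} em with long-suc em
  ... | k , eq = subst (λ m → Rm.Block G (Rm.labelWith G roman-label Vs) (mid e) (base m)) (sym eq)
      (use (roman-pattern k (T (src e)) (T (tgt e)) (admissible em (res (suc k)) (cong res eq))))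
    where
    stands : ∀ v → v ∈ Vs → Rm.Stands G (Rm.labelWith G roman-label Vs) v (lead (T v))
    stands v vm c hc = roman-label v , Rm.∈-labelWith G roman-label vm , two-label (T v) hc
      where
      two-label : ∀ t → toℕ (lead t) ≡ 2 → toℕ (romanOf t (pendants v)) ≡ 2
      two-label false _ = refl
    use : Pattern roman (lead (T (src e))) (lead (T (tgt e))) (suc k) (base (suc k)) →
          Rm.Block G (Rm.labelWith G roman-label Vs) (mid e) (base (suc k))
    use (mkPattern ws len fits cost) = Rm.chain-block G ws (walk inv em) (trans len (sym eq)) fits cost
      (stands (src e) (proj₁ (ends inv em))) (stands (tgt e) (proj₂ (ends inv em)))

  -- A five-cycle dominates itself with 3 here. With 3 more in the Roman labelling, the increase at
  -- a selected foot being charged to the foot, 20 - 18 = 2 remains: the 2 per pendant in `income`.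
  pendant-rainbow : ∀ {P} → P ∈ Ps → Rb.Block G (Rb.labelWith G rainbow-label Vs) (five P) 3
  pendant-rainbow {pendant y x a b c d} pm with circuit pm
  ... | xa ∷ ab ∷ bc ∷ cd ∷ last dx = Labels.block
    ((x , one true) ∷ (a , none) ∷ (b , one false) ∷ (c , none) ∷ (d , one true) ∷ []) refl
    (λ { (there (here refl)) _ true → x , one true , O+ (here refl) , Adj-sym G xa , refl
       ; (there (here refl)) _ false → b , one false , O+ (there (there (here refl))) , ab , refl
       ; (there (there (there (here refl)))) _ true → d , one true , O+ (there (there (there (there (here refl))))) , cd , refl
       ; (there (there (there (here refl)))) _ false → b , one false , O+ (there (there (here refl))) , Adj-sym G bc , refl
       ; (here refl) (() , _)
       ; (there (there (here refl))) (_ , ())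
       ; (there (there (there (there (here refl))))) (() , _) })
    ≤-refl
    where
    O+ : ∀ {z F} → z ∈ F → z ∈ Rb.labelWith G rainbow-label Vs ++ F
    O+ = ∈-++⁺ʳ (Rb.labelWith G rainbow-label Vs)

  Relieved : Pendant n → Rm.Labelled G → Set
  Relieved P F = T (foot P) ≡ true → Rm.Supplied G F (foot P) tt

  -- Below an unselected vertex the neighbour x of the foot is dominated from
  -- the foot; below a selected one, x dominates the foot instead.
  pendant-roman : ∀ {P} → P ∈ Ps →
    ∃ λ (X : Rm.Block G (Rm.labelWith G roman-label Vs) (five P) (3 + b2n (T (foot P)))) → Relieved P (Labels.Block.labels X)
  pendant-roman {pendant y x a b c d} pm with circuit pm | T y in t
  ... | xa ∷ ab ∷ bc ∷ cd ∷ last dx | true = Labels.block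
    ((x , 2F) ∷ (a , 0F) ∷ (b , 1F) ∷ (c , 1F) ∷ (d , 0F) ∷ []) refl
    (λ { (there (here refl)) _ _ → x , 2F , O+ (here refl) , Adj-sym G xa , refl
       ; (there (there (there (there (here refl))))) _ _ → x , 2F , O+ (here refl) , dx , refl
       ; (here refl) ()
       ; (there (there (here refl))) ()
       ; (there (there (there (here refl)))) () })
    ≤-refl , (λ _ → x , 2F , here refl , attached pm , refl)
    where
    O+ : ∀ {z F} → z ∈ F → z ∈ Rm.labelWith G roman-label Vs ++ F
    O+ = ∈-++⁺ʳ (Rm.labelWith G roman-label Vs)
  ... | xa ∷ ab ∷ bc ∷ cd ∷ last dx | false = Labels.block
    ((x , 0F) ∷ (a , 0F) ∷ (b , 2F) ∷ (c , 0F) ∷ (d , 1F) ∷ []) refl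
    (λ { (here refl) _ _ → y , roman-label y , ∈-++⁺ˡ (Rm.∈-labelWith G roman-label (footed pm)) , Adj-sym G (attached pm) ,
                           subst (λ b → toℕ (romanOf b (pendants y)) ≡ 2) (sym t) refl
       ; (there (here refl)) _ _ → b , 2F , O+ (there (there (here refl))) , ab , refl
       ; (there (there (there (here refl)))) _ _ → b , 2F , O+ (there (there (here refl))) , Adj-sym G bc , refl
       ; (there (there (here refl))) ()
       ; (there (there (there (there (here refl))))) () })
    ≤-refl , (λ ())
    where
    O+ : ∀ {z F} → z ∈ F → z ∈ Rm.labelWith G roman-label Vs ++ F
    O+ = ∈-++⁺ʳ (Rm.labelWith G roman-label Vs)

  vertices : List (Fin n)
  vertices = Vs ++ (concatMap mid Cs ++ concatMap five Ps)

  rainbow-cost roman-cost : ℕ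
  rainbow-cost = ⅀ (λ v → Rule.wt rainbow (rainbow-label v)) Vs +
                 (⅀ (λ e → base (length (mid e)) + penalty s e) Cs + ⅀ (λ _ → 3) Ps)
  roman-cost = ⅀ (λ v → toℕ (roman-label v)) Vs +
               (⅀ (λ e → base (length (mid e))) Cs + ⅀ (λ P → 3 + b2n (T (foot P))) Ps)

  rainbow-labelling : Rb.Labelling G vertices rainbow-cost
  rainbow-labelling = Rb.close G rainbow-label Vs
    (Rb.block-++ G
      (proj₁ (Rb.blocks G mid _ (λ _ _ → ⊤) (λ _ _ → tt) Cs (λ em → chain-rainbow em , tt)))
      (proj₁ (Rb.blocks G five _ (λ _ _ → ⊤) (λ _ _ → tt) Ps (λ pm → pendant-rainbow pm , tt))))
    (λ {v} _ nd → ⊥-elim (nonempty (poor v) (s v) nd))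
    where
    nonempty : ∀ a t → ¬ IsEmptyLabel (colour a t)
    nonempty true  true  (() , _)
    nonempty true  false (_ , ())
    nonempty false _     (() , _)

  roman-labelling : Rm.Labelling G vertices roman-cost
  roman-labelling with Rm.blocks G {O = Rm.labelWith G roman-label Vs} mid _ (λ _ _ → ⊤) (λ _ _ → tt) Cs (λ em → chain-roman em , tt)
                     | Rm.blocks G {O = Rm.labelWith G roman-label Vs} five _ Relieved (λ s r t → Rm.Supplied-⊆ G s (r t)) Ps pendant-roman
  ... | X , _ | Y , relieved = Rm.close G roman-label Vs (Rm.block-++ G X Y) supplied
    where
    supplied : ∀ {v} → v ∈ Vs → toℕ (roman-label v) ≡ 0 → ∀ c →
      Rm.Supplied G (Rm.labelWith G roman-label Vs ++ (Labels.Block.labels X ++ Labels.Block.labels Y)) v c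
    supplied {v} vm nd tt with romanOf-zero (T v) (pendants v) nd
      where
      romanOf-zero : ∀ t k → toℕ (romanOf t k) ≡ 0 → t ≡ true × 1 ≤ k
      romanOf-zero true (suc k) _ = refl , s≤s z≤n
    -- Label 0 arises only at a selected vertex with a pendant, and the vertex `x` of that pendant
    -- carries 2.
    ... | t , 1≤ with positive-term (λ P → δ v (foot P)) Ps 1≤
    ...   | P , pm , 1≤δ with 1≤δ⇒≡ {v = v} 1≤δ
    ...     | refl = Rm.Supplied-⊆ G (∈-++⁺ʳ (Rm.labelWith G roman-label Vs) ∘ ∈-++⁺ʳ (Labels.Block.labels X)) (relieved pm t)

  -- In thirds, the strongest labels cost 12 at a branch vertex worth 4, and `total` covers these 8
  -- by income and savings. Chains are settled by `base-half`, pendants by 20 = 18 + 2.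
  cost-bound : 3 * (rainbow-cost + roman-cost) ≤ 4 * length vertices
  cost-bound = ≤-trans (≤-reflexive split) (≤-trans (≤-linear 0
      (+-mono-≤ (*-monoʳ-≤ 3 (+-mono-≤ (≤-reflexive rainbow-vertices) roman-vertices))
                (+-mono-≤ total (≤-reflexive total-income)))
      (lemma′ SF SG SB SU (length Ps) ST SA SP (length Vs) (⅀ h Cs) (⅀ income Vs)))
      (≤-reflexive join-up))
    where
    SF = ⅀ (λ v → Rule.wt rainbow (rainbow-label v)) Vs
    SG = ⅀ (λ v → toℕ (roman-label v)) Vs
    SB = ⅀ (λ e → base (length (mid e))) Cs
    SU = ⅀ (penalty s) Cs
    ST = ⅀ (λ v → b2n (T v)) Vs
    SA = ⅀ (λ v → b2n (poor v)) Vs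
    SP = ⅀ (λ P → b2n (T (foot P))) Ps
    split : 3 * (rainbow-cost + roman-cost) ≡ 3 * (SF + (SB + SU + 3 * length Ps) + (SG + (SB + (3 * length Ps + SP))))
    split = cong (3 *_) (cong₂ _+_
      (cong (SF +_) (cong₂ _+_ (⅀-+ (λ e → base (length (mid e))) (penalty s) Cs) (⅀-const 3 Ps)))
      (cong (λ k → SG + (SB + k)) (trans (⅀-+ (λ _ → 3) (λ P → b2n (T (foot P))) Ps) (cong (_+ SP) (⅀-const 3 Ps)))))
    rainbow-vertices : SF + SA ≡ 2 * length Vs
    rainbow-vertices = trans (sym (⅀-+ _ (λ v → b2n (poor v)) Vs))
      (trans (⅀-cong Vs (λ {v} _ → colour-weight (poor v) (s v))) (⅀-const 2 Vs))
    roman-vertices : SG + ST + SP ≤ 2 * length Vs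
    roman-vertices = ≤-trans (≤-reflexive (sym (trans
        (⅀-+ (λ v → toℕ (roman-label v) + b2n (T v)) (λ v → b2n (T v) * pendants v) Vs)
        (cong₂ _+_ (⅀-+ (λ v → toℕ (roman-label v)) (λ v → b2n (T v)) Vs) (pendant-count (λ v → b2n (T v)))))))
      (≤-trans (⅀-mono Vs (λ {v} _ → roman-weight (T v) (pendants v) (chosen-pendants v))) (≤-reflexive (⅀-const 2 Vs)))
    lemma′ : ∀ f g b u m t a p l hs i →
      3 * (f + (b + u + 3 * m) + (g + (b + (3 * m + p)))) +
        (3 * (2 * l + 2 * l) + (i + 3 * a + 3 * t + (2 * hs + 2 * m))) + 0 ≡
      4 * l + (6 * b + 2 * hs) + 20 * m + (3 * (f + a + (g + t + p)) + (8 * l + 3 * u + i))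
    lemma′ = solve-∀
    join-up : 4 * length Vs + (6 * SB + 2 * ⅀ h Cs) + 20 * length Ps ≡ 4 * length vertices
    join-up = begin
      4 * length Vs + (6 * SB + 2 * ⅀ h Cs) + 20 * length Ps
        ≡⟨ cong (λ k → 4 * length Vs + k + 20 * length Ps) chain-length ⟩
      4 * length Vs + 4 * ⅀ (λ e → length (mid e)) Cs + 20 * length Ps
        ≡⟨ lemma″ (length Vs) (⅀ (λ e → length (mid e)) Cs) (length Ps) ⟩
      4 * (length Vs + (⅀ (λ e → length (mid e)) Cs + 5 * length Ps))
        ≡⟨ cong (λ k → 4 * (length Vs + k)) (cong₂ _+_ (length-concatMap mid Cs)
             (trans (length-concatMap five Ps) (⅀-const 5 Ps))) ⟨
      4 * (length Vs + (length (concatMap mid Cs) + length (concatMap five Ps)))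
        ≡⟨ cong (λ k → 4 * (length Vs + k)) (length-++ (concatMap mid Cs)) ⟨
      4 * (length Vs + length (concatMap mid Cs ++ concatMap five Ps))
        ≡⟨ cong (4 *_) (length-++ Vs) ⟨
      4 * length vertices ∎
      where
      open ≡-Reasoning
      lemma″ : ∀ l c m → 4 * l + 4 * c + 20 * m ≡ 4 * (l + (c + 5 * m))
      lemma″ = solve-∀
      chain-length : 6 * SB + 2 * ⅀ h Cs ≡ 4 * ⅀ (λ e → length (mid e)) Cs
      chain-length = begin
        6 * SB + 2 * ⅀ h Cs
          ≡⟨ cong₂ _+_ (⅀-* 6 (λ e → base (length (mid e))) Cs) (⅀-* 2 h Cs) ⟨
        ⅀ (λ e → 6 * base (length (mid e))) Cs + ⅀ (λ e → 2 * h e) Cs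
          ≡⟨ ⅀-+ (λ e → 6 * base (length (mid e))) (λ e → 2 * h e) Cs ⟨
        ⅀ (λ e → 6 * base (length (mid e)) + 2 * h e) Cs
          ≡⟨ ⅀-cong Cs (λ {e} em → let k , eq = long-suc em in
               subst (λ m → 6 * base m + 2 * half (res m) ≡ 4 * m) (sym eq) (base-half k)) ⟩
        ⅀ (λ e → 4 * length (mid e)) Cs
          ≡⟨ ⅀-* 4 (λ e → length (mid e)) Cs ⟩
        4 * ⅀ (λ e → length (mid e)) Cs ∎

  good : Good G vertices
  good = rainbow-cost , roman-cost , rainbow-labelling , roman-labelling , cost-bound

-- Turning hanging five-cycles into pendants

module _ {n : ℕ} (G : Graph n) where
  open Chain

  feet : Fin n → List (Pendant n) → ℕ
  feet v = ⅀ (λ P → δ v (foot P))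

  -- A five-cycle takes two of the three places at `v`; deleting an edge in the third would cut it
  -- off.
  Capped : Fin n → List (Chain n) → List (Pendant n) → Set
  Capped v Cs Ps = deg v Cs + feet v Ps ≡ 3 × FourLoop v Cs

  -- Between deletion and discharging: the direct edges still present are at capped vertices, and
  -- each becomes the edge of a pendant.
  record Draft (Vs : List (Fin n)) (Cs : List (Chain n)) (Ps : List (Pendant n)) : Set where
    field
      inv      : Inv G Vs Cs
      footed   : ∀ {P} → P ∈ Ps → foot P ∈ Vs
      attached : ∀ {P} → P ∈ Ps → Adj G (foot P) (Pendant.x P)
      circuit  : ∀ {y x a b c d} → pendant y x a b c d ∈ Ps → Walk G x (a ∷ b ∷ c ∷ d ∷ []) x
      branch   : ∀ {v} → v ∈ Vs → 3 ≤ deg v Cs + feet v Ps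
      capped   : ∀ {e} → e ∈ Cs → mid e ≡ [] → Capped (src e) Cs Ps ⊎ Capped (tgt e) Cs Ps

  null? : (e : Chain n) → Dec (mid e ≡ [])
  null? (chain _ [] _)      = yes refl
  null? (chain _ (_ ∷ _) _) = no λ ()

  ∈-tail : ∀ {x y} {Vs : List (Fin n)} → x ∈ y ∷ Vs → x ≢ y → x ∈ Vs
  ∈-tail (here refl) ≢ = ⊥-elim (≢ refl)
  ∈-tail (there m)   _ = m

  ∈-tail-≢ : ∀ {x y} {Vs : List (Fin n)} → Unique (y ∷ Vs) → x ∈ Vs → x ≢ y
  ∈-tail-≢ (ps ∷ _) m refl = All.lookup ps m refl

  module Cap {Vs Cs Ps x y Cs₁} (D : Draft Vs Cs Ps) (eq : Cs ≈ chain x [] y ∷ Cs₁)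
             (d3 : deg x Cs + feet x Ps ≡ 3) where
    open Draft D

    step-inv : Inv G Vs (chain x [] y ∷ Cs₁)
    step-inv = Inv-≈ G eq inv

    xy : Adj G x y
    xy with walk step-inv (here refl)
    ... | last e = e

    module Loop {a b c d rest} (eq′ : Cs₁ ↭ chain x (a ∷ b ∷ c ∷ d ∷ []) x ∷ rest)
                {Vs′} (veq : Vs ↭ x ∷ Vs′) where

      loop-chain : Chain n
      loop-chain = chain x (a ∷ b ∷ c ∷ d ∷ []) x

      eq″ : Cs ≈ chain x [] y ∷ loop-chain ∷ rest
      eq″ = eq ⟫ perm (prep _ eq′)

      inv″ : Inv G (x ∷ Vs′) (chain x [] y ∷ loop-chain ∷ rest)
      inv″ = Inv-↭ G veq (Inv-≈ G eq″ inv)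

      rest0 : deg x rest + feet x Ps ≡ 0
      rest0 = +-cancelˡ-≡ 3 _ _ (begin
        3 + (deg x rest + feet x Ps)
          ≡⟨ cong₂ (λ i j → i + j + (i + i + deg x rest) + feet x Ps) (δ-refl x) (δ-≢ {v = x} (Adj-≢ G xy)) ⟨
        deg x (chain x [] y ∷ loop-chain ∷ rest) + feet x Ps
          ≡⟨ cong (_+ feet x Ps) (deg-≈ x eq″) ⟨
        deg x Cs + feet x Ps
          ≡⟨ d3 ⟩
        3 ∎)
        where open ≡-Reasoning

      inv′ : Inv G Vs′ rest
      inv′ = Inv-drop G (Inv-tail G (Inv-tail G inv″)) (m+n≡0⇒m≡0 _ rest0)

      new : Pendant n
      new = pendant y x a b c d

      -- At `y` the lost edge end is replaced by a foot, so the number of places does not change and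
      -- no new vertex of degree 2 appears.
      degrees : ∀ {w} → w ≢ x → deg w rest + feet w (new ∷ Ps) ≡ deg w Cs + feet w Ps
      degrees {w} w≢x = begin
        deg w rest + (δ w y + feet w Ps)
          ≡⟨ lemma (deg w rest) (δ w y) (feet w Ps) ⟩
        0 + δ w y + (0 + 0 + deg w rest) + feet w Ps
          ≡⟨ cong (λ i → i + δ w y + (i + i + deg w rest) + feet w Ps) (δ-≢ {v = w} w≢x) ⟨
        deg w (chain x [] y ∷ loop-chain ∷ rest) + feet w Ps
          ≡⟨ cong (_+ feet w Ps) (deg-≈ w eq″) ⟨
        deg w Cs + feet w Ps ∎
        where
        open ≡-Reasoning
        lemma : ∀ a b c → a + (b + c) ≡ 0 + b + (0 + 0 + a) + c
        lemma = solve-∀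

      other : ∀ {w} → w ∈ Vs′ → w ≢ x
      other = ∈-tail-≢ (uniq inv″)

      capped-still : ∀ {w} → w ∈ Vs′ → Capped w Cs Ps → Capped w rest (new ∷ Ps)
      capped-still {w} wm (d , l) with FourLoop-≈ eq″ l
      ... | p , here refl , ()
      ... | p , there (here refl) , _ = ⊥-elim (other wm refl)
      ... | p , there (there m) , l4 = trans (degrees (other wm)) d , p , m , l4

      draft : Draft Vs′ rest (new ∷ Ps)
      draft = record
        { inv      = inv′
        ; footed   = λ { (here refl) → ∈-tail (proj₂ (ends inv″ (here refl))) (λ e → Adj-≢ G xy (sym e))
                       ; (there m) → ∈-tail (∈-resp-↭ veq (footed m))
                           (λ e → δ≡0⇒≢ (⅀≡0⇒ (λ P → δ x (foot P)) Ps (m+n≡0⇒n≡0 (deg x rest) rest0) m) (sym e)) }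
        ; attached = λ { (here refl) → Adj-sym G xy ; (there m) → attached m }
        ; circuit  = λ { (here refl) → walk inv″ (there (here refl)) ; (there m) → circuit m }
        ; branch   = λ wm → subst (3 ≤_) (sym (degrees (other wm))) (branch (∈-resp-↭ (↭-sym veq) (there wm)))
        ; capped   = capped′
        }
        where
        capped′ : ∀ {e} → e ∈ rest → mid e ≡ [] → Capped (src e) rest (new ∷ Ps) ⊎ Capped (tgt e) rest (new ∷ Ps)
        capped′ {e} m null with ends inv′ m | ≈-∈ eq″ (there (there m))
        ... | sm , tm | inj₁ m′ = [ inj₁ ∘ capped-still sm , inj₂ ∘ capped-still tm ]′ (capped m′ null)
        ... | sm , tm | inj₂ m′ =
          [ inj₂ ∘ capped-still tm , inj₁ ∘ capped-still sm ]′ (capped m′ (cong reverse null))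

      shorter : length rest < length Cs
      shorter = ≤-trans (n≤1+n _) (≤-reflexive (sym (≈-length eq″)))

      verts : Vs′ ++ (ints rest ++ concatMap five (new ∷ Ps)) ↭ Vs ++ (ints Cs ++ concatMap five Ps)
      verts = ↭-sym (↭-trans (++⁺ veq (++⁺ʳ (concatMap five Ps) (≈-ints eq″)))
        (↭-trans (↭-sym (shift x Vs′ _)) (++⁺ˡ Vs′
          (↭-trans (++⁺ʳ (concatMap five Ps) (++-comm (five new) (ints rest)))
                   (++-assoc (ints rest) (five new) (concatMap five Ps))))))

  cap : ∀ k {Vs Cs Ps} → length Cs ≤ k → Draft Vs Cs Ps → Good G (Vs ++ (ints Cs ++ concatMap five Ps))
  cap-step : ∀ k {Vs Cs Ps x y Cs₁} → length Cs ≤ suc k → Draft Vs Cs Ps → Cs ≈ chain x [] y ∷ Cs₁ →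
             Capped x Cs Ps → Good G (Vs ++ (ints Cs ++ concatMap five Ps))

  cap-step k {Vs} {Cs} {Ps} {x} {y} le D eq (d3 , l) with FourLoop-≈ eq l
  ... | [] , here refl , ()
  ... | a ∷ b ∷ c ∷ d ∷ [] , there m , refl with ∈⇒↭ m
  ...   | rest , eq′ with ∈⇒↭ (proj₁ (ends (Inv-≈ G eq (Draft.inv D)) (here refl)))
  ...     | Vs′ , veq = Good-↭ G L.verts (cap k (≤-pred (≤-trans L.shorter le)) L.draft)
    where module L = Cap.Loop D eq d3 eq′ veq

  cap k {Vs} {Cs} {Ps} le D with any? null? Cs
  ... | no ¬null = Discharged.good terminal (proj₂ balanced) (proj₂ (select Vs))
    where
    open Discharging G Vs Cs Ps
    terminal : Terminal G Vs Cs Ps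
    terminal = record
      { inv = Draft.inv D ; long = λ m null → ¬null (lose m null) ; footed = Draft.footed D
      ; attached = Draft.attached D ; circuit = Draft.circuit D ; branch = Draft.branch D }
  ... | yes a with find a
  cap zero {Cs = []} le D | yes a | _ , () , _
  cap zero {Cs = _ ∷ _} () D | yes a | _
  cap (suc k) {Vs} {Cs} le D | yes a | chain x [] y , m , refl with ∈⇒↭ m | Draft.capped D m refl
  ...   | Cs₁ , eq | inj₁ c = cap-step k le D (perm eq) c
  ...   | Cs₁ , eq | inj₂ c = cap-step k le D (perm eq ⟫ turn) c

  Good-[] : Good G []
  Good-[] = 0 , 0 , Labels.labelling [] ↭-refl (λ ()) z≤n , Labels.labelling [] ↭-refl (λ ()) z≤n , z≤n

  -- Covers both outcomes at `v`: untouched if its degree is at least 3, suppressed if it is 2.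
  record Settled (v : Fin n) (Vs : List (Fin n)) (Cs : List (Chain n)) : Set where
    field
      {Vs′ removed} : List (Fin n)
      {Cs′}         : List (Chain n)
      inv     : Inv G Vs′ Cs′
      good    : Good G removed
      verts   : Vs ++ ints Cs ↭ removed ++ (Vs′ ++ ints Cs′)
      degrees : ∀ {w} → w ≢ v → deg w Cs′ ≡ deg w Cs
      kept    : ∀ {w} → w ∈ Vs → w ≢ v → w ∈ Vs′
      sub     : ∀ {w} → w ∈ Vs′ → w ∈ Vs
      branch  : v ∈ Vs′ → 3 ≤ deg v Cs′
      gone    : deg v Cs ≡ 2 → ¬ v ∈ Vs′
      ≤-chains : length Cs′ ≤ length Cs
      <-chains : deg v Cs ≡ 2 → length Cs′ < length Cs
      origin  : ∀ {e} → e ∈ Cs′ → (e ∈ Cs ⊎ flip e ∈ Cs) ⊎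
                ∃ λ p → ∃ λ z → ∃ λ q → ∃ λ z′ → ∃ λ rest →
                  Cs ≈ chain v p z ∷ chain v q z′ ∷ rest × e ≡ join G v p z q z′

  -- The last argument answers for the five-cycle, which `cycle-good` rejects: it is either refuted
  -- or completed to a house.
  settle : ∀ {v Vs Cs} → Inv G Vs Cs → v ∈ Vs → 2 ≤ deg v Cs →
           (∀ {p rest} → deg v Cs ≡ 2 → Cs ≈ chain v p v ∷ rest → length p ≡ 4 → Good G (v ∷ p)) →
           Settled v Vs Cs
  settle {v} {Vs} {Cs} i vm 2≤ four with deg v Cs ≟ℕ 2
  ... | no ≢2 = record
    { inv = i ; good = Good-[] ; verts = ↭-refl ; degrees = λ _ → refl ; kept = λ m _ → m ; sub = λ m → m
    ; branch = λ _ → ≤∧≢⇒< 2≤ (≢2 ∘ sym) ; gone = λ d → ⊥-elim (≢2 d) ; ≤-chains = ≤-refl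
    ; <-chains = λ d → ⊥-elim (≢2 d) ; origin = inj₁ ∘ inj₁ }
  ... | yes d2 with ∈⇒↭ vm
  ...   | Vs′ , veq = record
    { inv      = C.inv
    ; good     = removed-good C.cyclic
    ; verts    = ↭-trans (++⁺ʳ (ints Cs) veq) (↭-trans (↭-sym (shift v Vs′ (ints Cs)))
        (↭-trans (++⁺ˡ Vs′ C.verts) (shifts Vs′ C.removed)))
    ; degrees  = C.degrees
    ; kept     = λ m ≢v → ∈-tail (∈-resp-↭ veq m) ≢v
    ; sub      = λ m → ∈-resp-↭ (↭-sym veq) (there m)
    ; branch   = λ m → ⊥-elim (absent m)
    ; gone     = λ _ → absent
    ; ≤-chains = <⇒≤ C.shorter
    ; <-chains = λ _ → C.shorter
    ; origin   = C.origin
    }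
    where
    i′ : Inv G (v ∷ Vs′) Cs
    i′ = Inv-↭ G veq i
    module C = Contraction (contract G i′ d2)
    absent : ¬ v ∈ Vs′
    absent m = ∈-tail-≢ (uniq i′) m refl
    removed-good : ∀ {r} → r ≡ [] ⊎ (∃ λ p → r ≡ v ∷ p × ∃ λ rest → Cs ≈ chain v p v ∷ rest) → Good G r
    removed-good (inj₁ refl) = Good-[]
    removed-good (inj₂ (p , refl , rest , eq)) with length p ≟ℕ 4
    ... | yes l4 = four d2 eq l4
    ... | no ≢4 = cycle-good G (walk (Inv-≈ G eq i) (here refl)) (loop (Inv-≈ G eq i) (here refl) refl) ≢4

-- Deleting direct edges

module _ {n : ℕ} (G : Graph n) where
  open Chain

  -- Contracting a vertex x of a chord xy can close a five-cycle at y only if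
  -- the chord subdivides it into a triangle and a four-cycle.
  chord-good : ∀ {Vs x y p q rest} → Inv G Vs (chain x [] y ∷ chain x p y ∷ chain x q y ∷ rest) →
               length (reverse p ++ x ∷ q) ≡ 4 → Good G (y ∷ (reverse p ++ x ∷ q))
  chord-good {x = x} {y} {p} {q} {rest} i l = by-shape p q
      (λ p≡[] → simple-bound (≤-trans (links-self {x = x} {y} p≡[]) (m≤m+n _ _)))
      (λ q≡[] → simple-bound (≤-trans (links-self {x = x} {y} q≡[]) (m≤n+m _ (links x y (chain x p y)))))
      (walk i (here refl)) (walk i (there (here refl))) (walk i (there (there (here refl)))) l
    where
    simple-bound : ¬ 1 ≤ links x y (chain x p y) + links x y (chain x q y)
    simple-bound le = 1+n≰n (≤-trans (+-mono-≤ (links-self {x = x} {y} refl)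
      (≤-trans le (≤-trans (m≤m+n _ (⅀ (links x y) rest)) (≤-reflexive (+-assoc (links x y (chain x p y)) _ _)))))
      (simple i x y))
    by-shape : ∀ p q → p ≢ [] → q ≢ [] → Walk G x [] y → Walk G x p y → Walk G x q y →
               length (reverse p ++ x ∷ q) ≡ 4 → Good G (y ∷ (reverse p ++ x ∷ q))
    by-shape [] _ p≢ _ _ _ _ _ = ⊥-elim (p≢ refl)
    by-shape (_ ∷ _) [] _ q≢ _ _ _ _ = ⊥-elim (q≢ refl)
    by-shape (a ∷ []) (b ∷ c ∷ []) _ _ (last xy) wp wq _ = Good-↭ G
      (↭-trans (swap x y refl) (prep y (swap x a refl))) (house-good G xy wp wq)
    by-shape (a ∷ b ∷ []) (c ∷ []) _ _ (last xy) wp wq _ = Good-↭ G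
      perm′ (house-good G xy wq wp)
      where
      perm′ : x ∷ y ∷ c ∷ a ∷ b ∷ [] ↭ y ∷ b ∷ a ∷ x ∷ c ∷ []
      perm′ = ↭-trans (swap x y refl) (prep y (↭-trans (++⁺ˡ (x ∷ c ∷ []) (swap a b refl))
        (++-comm (x ∷ c ∷ []) (b ∷ a ∷ []))))
    by-shape (_ ∷ []) (_ ∷ []) _ _ _ _ _ ()
    by-shape (_ ∷ []) (_ ∷ _ ∷ _ ∷ _) _ _ _ _ _ ()
    by-shape (_ ∷ _ ∷ []) (_ ∷ _ ∷ _) _ _ _ _ _ ()
    by-shape p@(a ∷ b ∷ c ∷ p′) q@(d ∷ q′) _ _ _ _ _ l = ⊥-elim (1+n≰n (≤-trans
      (+-mono-≤ (m≤m+n 3 (length p′)) (m≤m+n 2 (length q′)))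
      (≤-reflexive (trans (sym (trans (length-++ (reverse p)) (cong (_+ suc (length q)) (length-reverse p)))) l))))

  fourLoop? : (v : Fin n) (Cs : List (Chain n)) → Dec (FourLoop v Cs)
  fourLoop? v Cs with any? (λ e → (src e ≟ v) ×-dec ((tgt e ≟ v) ×-dec (length (mid e) ≟ℕ 4))) Cs
  ... | yes a with find a
  ...   | chain _ p _ , m , refl , refl , l = yes (p , m , l)
  fourLoop? v Cs | no ¬a = no (λ { (p , m , l) → ¬a (lose m (refl , refl , l)) })

  capped? : ∀ v Cs → Dec (Capped G v Cs [])
  capped? v Cs = (deg v Cs + 0 ≟ℕ 3) ×-dec fourLoop? v Cs

  Removable : List (Chain n) → Chain n → Set
  Removable Cs e = mid e ≡ [] × ¬ Capped G (src e) Cs [] × ¬ Capped G (tgt e) Cs []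

  removable? : ∀ Cs e → Dec (Removable Cs e)
  removable? Cs e = null? G e ×-dec (¬? (capped? (src e) Cs) ×-dec ¬? (capped? (tgt e) Cs))

  -- Without the edge, `x` and then `y` may drop to degree 2 and are suppressed. A five-cycle
  -- splitting off at either would mean that this end was capped before, unless it arose at `y` by
  -- suppressing `x`.
  module Remove {Vs Cs x y Cs₁} (i : Inv G Vs Cs) (branch : ∀ {v} → v ∈ Vs → 3 ≤ deg v Cs)
                (eq : Cs ↭ chain x [] y ∷ Cs₁) (¬cx : ¬ Capped G x Cs []) (¬cy : ¬ Capped G y Cs []) where

    i₀ : Inv G Vs (chain x [] y ∷ Cs₁)
    i₀ = Inv-≈ G (perm eq) i

    i₁ : Inv G Vs Cs₁
    i₁ = Inv-tail G i₀

    x≢y : x ≢ y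
    x≢y with walk i₀ (here refl)
    ... | last e = Adj-≢ G e

    xm : x ∈ Vs
    xm = proj₁ (ends i₀ (here refl))

    ym : y ∈ Vs
    ym = proj₂ (ends i₀ (here refl))

    deg-x : suc (deg x Cs₁) ≡ deg x Cs
    deg-x = trans (cong₂ (λ a b → a + b + deg x Cs₁) (sym (δ-refl x)) (sym (δ-≢ {v = x} x≢y))) (sym (deg-≈ x (perm eq)))

    deg-y : suc (deg y Cs₁) ≡ deg y Cs
    deg-y = trans (cong₂ (λ a b → a + b + deg y Cs₁) (sym (δ-≢ {v = y} (x≢y ∘ sym))) (sym (δ-refl y))) (sym (deg-≈ y (perm eq)))

    deg-other : ∀ {w} → w ≢ x → w ≢ y → deg w Cs₁ ≡ deg w Cs
    deg-other {w} wx wy = trans (cong₂ (λ a b → a + b + deg w Cs₁) (sym (δ-≢ {v = w} wx)) (sym (δ-≢ {v = w} wy)))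
      (sym (deg-≈ w (perm eq)))

    four-up : ∀ {v} → FourLoop v Cs₁ → FourLoop v Cs
    four-up (p , m , l) = p , ∈-resp-↭ (↭-sym eq) (there m) , l

    capped-if : ∀ {v} → suc (deg v Cs₁) ≡ deg v Cs → deg v Cs₁ ≡ 2 → FourLoop v Cs₁ → Capped G v Cs []
    capped-if {v} ds d2 f = trans (+-identityʳ (deg v Cs)) (trans (sym ds) (cong suc d2)) , four-up f

    X : Settled G x Vs Cs₁
    X = settle G i₁ xm (≤-pred (subst (3 ≤_) (sym deg-x) (branch xm)))
      (λ d2 eq′ l → ⊥-elim (¬cx (capped-if deg-x d2 (FourLoop-≈ (≈-sym eq′) (_ , here refl , l)))))

    module X = Settled X

    deg-y′ : deg y X.Cs′ ≡ deg y Cs₁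
    deg-y′ = X.degrees (x≢y ∘ sym)

    house-at : ∀ {p} → deg y X.Cs′ ≡ 2 → chain y p y ∈ X.Cs′ → length p ≡ 4 → Good G (y ∷ p)
    house-at {p} d2 m l with X.origin m
    ... | inj₁ (inj₁ m′) = ⊥-elim (¬cy (capped-if deg-y (trans (sym deg-y′) d2) (p , m′ , l)))
    ... | inj₁ (inj₂ m′) = ⊥-elim (¬cy (capped-if deg-y (trans (sym deg-y′) d2)
            (reverse p , m′ , trans (length-reverse p) l)))
    -- The loop is new, hence made of two chains from `x` to `y`, and the deleted edge is a chord of
    -- it.
    ... | inj₂ (q , _ , q′ , _ , rest , eq′ , refl) = chord-good (Inv-≈ G (≈-prep eq′) i₀) l

    Y : Settled G y X.Vs′ X.Cs′
    Y = settle G X.inv (X.kept ym (x≢y ∘ sym))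
        (subst (2 ≤_) (sym deg-y′) (≤-pred (subst (3 ≤_) (sym deg-y) (branch ym)))) house
      where
      house : ∀ {p rest} → deg y X.Cs′ ≡ 2 → X.Cs′ ≈ chain y p y ∷ rest → length p ≡ 4 → Good G (y ∷ p)
      house {p} d2 eq′ l with ≈-∈ eq′ (here refl)
      ... | inj₁ m = house-at d2 m l
      ... | inj₂ m = Good-↭ G (prep y (↭-reverse p)) (house-at d2 m (trans (length-reverse p) l))

    module Y = Settled Y

    branch′ : ∀ {w} → w ∈ Y.Vs′ → 3 ≤ deg w Y.Cs′
    branch′ {w} m with w ≟ y | w ≟ x
    ... | yes refl | _        = Y.branch m
    ... | no w≢y   | yes refl = subst (3 ≤_) (sym (Y.degrees w≢y)) (X.branch (Y.sub m))
    ... | no w≢y   | no w≢x   = subst (3 ≤_)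
      (sym (trans (Y.degrees w≢y) (trans (X.degrees w≢x) (deg-other w≢x w≢y)))) (branch (X.sub (Y.sub m)))

    verts : X.removed ++ (Y.removed ++ (Y.Vs′ ++ ints Y.Cs′)) ↭ Vs ++ ints Cs
    verts = ↭-sym (↭-trans (++⁺ˡ Vs (concatMap-↭ mid eq)) (↭-trans X.verts (++⁺ˡ X.removed Y.verts)))

    shorter : length Y.Cs′ < length Cs
    shorter = ≤-trans (s≤s (≤-trans Y.≤-chains X.≤-chains)) (≤-reflexive (sym (↭-length eq)))

  -- Both ends are settled right after each deletion, so the minimum degree 3 is restored before the
  -- next one. When no deletion is possible, every direct edge has a capped end.
  reduce : ∀ k {Vs Cs} → length Cs ≤ k → Inv G Vs Cs → (∀ {v} → v ∈ Vs → 3 ≤ deg v Cs) → Good G (Vs ++ ints Cs)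
  reduce k {Vs} {Cs} le i branch with any? (removable? Cs) Cs
  ... | no ¬r = Good-↭ G (++⁺ˡ Vs (++-identityʳ (ints Cs))) (cap G (length Cs) {Ps = []} ≤-refl (record
    { inv      = i
    ; footed   = λ ()
    ; attached = λ ()
    ; circuit  = λ ()
    ; branch   = λ m → subst (3 ≤_) (sym (+-identityʳ _)) (branch m)
    ; capped   = capped
    }))
    where
    capped : ∀ {e} → e ∈ Cs → mid e ≡ [] → Capped G (src e) Cs [] ⊎ Capped G (tgt e) Cs []
    capped {e} m null with capped? (src e) Cs | capped? (tgt e) Cs
    ... | yes c | _     = inj₁ c
    ... | no _  | yes c = inj₂ c
    ... | no ¬c | no ¬d = ⊥-elim (¬r (lose m (null , ¬c , ¬d)))
  ... | yes r with find r
  reduce zero {Cs = []} le i branch | yes r | _ , () , _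
  reduce zero {Cs = _ ∷ _} () i branch | yes r | _
  reduce (suc k) le i branch | yes r | chain x [] y , m , refl , ¬cx , ¬cy with ∈⇒↭ m
  ... | Cs₁ , eq = Good-↭ G R.verts (Good-++ G R.X.good (Good-++ G R.Y.good
          (reduce k (≤-pred (≤-trans R.shorter le)) R.Y.inv R.branch′)))
    where module R = Remove i branch eq ¬cx ¬cy

-- From the graph to its multigraph, and the exclusion of C5

Unique-++ˡ : {A : Set} (xs : List A) {ys : List A} → Unique (xs ++ ys) → Unique xs
Unique-++ˡ []       u        = []
Unique-++ˡ (x ∷ xs) (ps ∷ u) = All.tabulate (λ m → All.lookup ps (∈-++⁺ˡ m)) ∷ Unique-++ˡ xs u

Unique-++ʳ : {A : Set} (xs : List A) {ys : List A} → Unique (xs ++ ys) → Unique ys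
Unique-++ʳ []       u       = u
Unique-++ʳ (x ∷ xs) (_ ∷ u) = Unique-++ʳ xs u

Unique-++-disjoint : {A : Set} (xs : List A) {ys : List A} {z : A} → Unique (xs ++ ys) → z ∈ xs → ¬ z ∈ ys
Unique-++-disjoint (x ∷ xs) (ps ∷ u) (here refl) m′ = All.lookup ps (∈-++⁺ʳ xs m′) refl
Unique-++-disjoint (x ∷ xs) (ps ∷ u) (there m)   m′ = Unique-++-disjoint xs u m m′

lookup-injective : {A : Set} {xs : List A} → Unique xs → ∀ i j → lookup xs i ≡ lookup xs j → i ≡ j
lookup-injective {xs = x ∷ xs} u        zero    zero    eq = refl
lookup-injective {xs = x ∷ xs} (ps ∷ u) zero    (suc j) eq = ⊥-elim (All.lookup ps (∈-lookup j) eq)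
lookup-injective {xs = x ∷ xs} (ps ∷ u) (suc i) zero    eq = ⊥-elim (All.lookup ps (∈-lookup i) (sym eq))
lookup-injective {xs = x ∷ xs} (ps ∷ u) (suc i) (suc j) eq = cong suc (lookup-injective u i j eq)

next prev : Fin 5 → Fin 5
next 0F = 1F
next 1F = 2F
next 2F = 3F
next 3F = 4F
next 4F = 0F
prev 0F = 4F
prev 1F = 0F
prev 2F = 1F
prev 3F = 2F
prev 4F = 3F

next≢prev : ∀ i → next i ≢ prev i
next≢prev = from-yes (all? (λ i → ¬? (next i ≟ prev i)))

next-prev : ∀ i → next (prev i) ≡ i
next-prev = from-yes (all? (λ i → next (prev i) ≟ i))

c5adj-spec : ∀ i j → c5adj i j ≡ does (j ≟ next i) ∨ does (j ≟ prev i)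
c5adj-spec = from-yes (all? (λ i → all? (λ j → c5adj i j Bool.≟ (does (j ≟ next i) ∨ does (j ≟ prev i)))))

δ-sym : ∀ {n} (x y : Fin n) → δ x y ≡ δ y x
δ-sym x y with x ≟ y | y ≟ x
... | yes _    | yes _  = refl
... | yes refl | no ¬e  = ⊥-elim (¬e refl)
... | no ¬e    | yes e  = ⊥-elim (¬e (sym e))
... | no _     | no _   = refl

module _ {n : ℕ} (G : Graph n) where
  open Chain

  ⅀-δ-all : ∀ x (g : Fin n → ℕ) → ⅀ (λ v → δ v x * g v) (allFin n) ≡ g x
  ⅀-δ-all x g = ⅀-δ g (allFin n) (allFin⁺ n) (∈-allFin x)

  two-neighbours : ∀ {u a b c} → degree G u ≡ 2 → a ≢ b → Adj G u a → Adj G u b → Adj G u c → c ≡ a ⊎ c ≡ b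
  two-neighbours {u} {a} {b} {c} d2 a≢b ua ub uc with c ≟ a | c ≟ b
  ... | yes e | _     = inj₁ e
  ... | no _  | yes e = inj₂ e
  ... | no c≢a | no c≢b = ⊥-elim (1+n≰n (≤-trans (≤-reflexive (sym three)) (≤-trans (⅀-mono (allFin n) (λ {v} _ → at v)) (≤-reflexive d2))))
    where
    one-δ : ∀ x → ⅀ (λ v → δ v x) (allFin n) ≡ 1
    one-δ x = trans (⅀-cong (allFin n) (λ {v} _ → sym (*-identityʳ (δ v x)))) (⅀-δ-all x (λ _ → 1))
    three : ⅀ (λ v → δ v a + δ v b + δ v c) (allFin n) ≡ 3
    three = trans (⅀-+ (λ v → δ v a + δ v b) (λ v → δ v c) (allFin n))
      (cong₂ _+_ (trans (⅀-+ (λ v → δ v a) (λ v → δ v b) (allFin n)) (cong₂ _+_ (one-δ a) (one-δ b))) (one-δ c))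
    at : ∀ v → δ v a + δ v b + δ v c ≤ b2n (adj G u v)
    at v with v ≟ a | v ≟ b | v ≟ c
    ... | yes refl | yes refl | _        = ⊥-elim (a≢b refl)
    ... | yes refl | no _     | yes refl = ⊥-elim (c≢a refl)
    ... | no _     | yes refl | yes refl = ⊥-elim (c≢b refl)
    ... | yes refl | no _     | no _     = ≤-reflexive (cong b2n (sym ua))
    ... | no _     | yes refl | no _     = ≤-reflexive (cong b2n (sym ub))
    ... | no _     | no _     | yes refl = ≤-reflexive (cong b2n (sym uc))
    ... | no _     | no _     | no _     = z≤n

  -- Vertices of degree 2 have no neighbours but those on the cycle, so by connectivity the cycle
  -- exhausts `G`, and it has no chord.
  five-cycle : ∀ {v p} → Connected G → Walk G v p v → length p ≡ 4 → Unique (v ∷ p) →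
               (∀ {u} → u ∈ v ∷ p → degree G u ≡ 2) → Isomorphic G C5
  five-cycle {v} {a ∷ b ∷ c ∷ d ∷ []} conn (va ∷ ab ∷ bc ∷ cd ∷ last dv) _ u deg2 =
    mk⤖ (injective , λ i → w i , λ { refl → w-injective _ _ (w-index (w i)) }) , preserves
    where
    w : Fin 5 → Fin n
    w = lookup (v ∷ a ∷ b ∷ c ∷ d ∷ [])
    w-injective : ∀ i j → w i ≡ w j → i ≡ j
    w-injective = lookup-injective u
    to-next : ∀ i → Adj G (w i) (w (next i))
    to-next 0F = va
    to-next 1F = ab
    to-next 2F = bc
    to-next 3F = cd
    to-next 4F = dv
    to-prev : ∀ i → Adj G (w i) (w (prev i))
    to-prev i = Adj-sym G (subst (λ j → Adj G (w (prev i)) (w j)) (next-prev i) (to-next (prev i)))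
    neighbours : ∀ i {z} → Adj G (w i) z → z ≡ w (next i) ⊎ z ≡ w (prev i)
    neighbours i = two-neighbours (deg2 (∈-lookup i)) (λ e → next≢prev i (w-injective _ _ e)) (to-next i) (to-prev i)
    cover : ∀ {x z} → Reach G x z → ∃ (λ i → w i ≡ x) → ∃ (λ i → w i ≡ z)
    cover here            m          = m
    cover (step xy reach) (i , refl) with neighbours i xy
    ... | inj₁ refl = cover reach (next i , refl)
    ... | inj₂ refl = cover reach (prev i , refl)
    index : Fin n → Fin 5
    index z = proj₁ (cover (conn v z) (0F , refl))
    w-index : ∀ z → w (index z) ≡ z
    w-index z = proj₂ (cover (conn v z) (0F , refl))
    injective : ∀ {x z} → index x ≡ index z → x ≡ z
    injective {x} {z} e = trans (sym (w-index x)) (trans (cong w e) (w-index z))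
    adj-w : ∀ i j → c5adj i j ≡ adj G (w i) (w j)
    adj-w i j = trans (c5adj-spec i j) (sym spec)
      where
      spec : adj G (w i) (w j) ≡ does (j ≟ next i) ∨ does (j ≟ prev i)
      spec with j ≟ next i | j ≟ prev i
      ... | yes refl | _        = to-next i
      ... | no _     | yes refl = to-prev i
      ... | no ¬n    | no ¬p with adj G (w i) (w j) in e
      ...   | false = refl
      ...   | true  = ⊥-elim ([ (λ e → ¬n (w-injective _ _ e)) , (λ e → ¬p (w-injective _ _ e)) ]′ (neighbours i e))
    preserves : ∀ x z → c5adj (index x) (index z) ≡ adj G x z
    preserves x z = trans (adj-w (index x) (index z)) (cong₂ (adj G) (w-index x) (w-index z))

  -- As long as no edge has been deleted, remaining vertices keep their degrees in `G` and inner
  -- ones have degree 2. Hence a five-cycle splitting off would be a whole component of `G`.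
  record Subdivision (Vs : List (Fin n)) (Cs : List (Chain n)) : Set where
    field
      inv      : Inv G Vs Cs
      distinct : Unique (Vs ++ ints Cs)
      degrees  : ∀ {v} → v ∈ Vs → deg v Cs ≡ degree G v
      inner    : ∀ {v} → v ∈ ints Cs → degree G v ≡ 2

  suppress : ∀ k {Vs Cs} → Connected G → MinDegreeAtLeast G 2 → ¬ Isomorphic G C5 →
             length Cs ≤ k → Subdivision Vs Cs → Good G (Vs ++ ints Cs)
  suppress k {Vs} {Cs} conn δ≥2 ¬C5 le D with any? (λ v → deg v Cs ≟ℕ 2) Vs
  ... | no ¬2 = reduce G (length Cs) ≤-refl inv
      (λ {v} m → ≤∧≢⇒< (subst (2 ≤_) (sym (degrees m)) (δ≥2 v)) (λ e → ¬2 (lose m (sym e))))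
    where open Subdivision D
  ... | yes a with find a
  suppress zero {Cs = []} conn δ≥2 ¬C5 le D | yes a | _ , _ , ()
  suppress zero {Cs = _ ∷ _} conn δ≥2 ¬C5 () D | yes a | _
  suppress (suc k) {Vs} {Cs} conn δ≥2 ¬C5 le D | yes a | v , vm , d2 =
    Good-↭ G (↭-sym S.verts) (Good-++ G S.good
      (suppress k conn δ≥2 ¬C5 (≤-pred (≤-trans (S.<-chains d2) le)) (record
        { inv      = S.inv
        ; distinct = distinct′
        ; degrees  = λ {w} m → trans (S.degrees (≢v m)) (degrees (S.sub m))
        ; inner    = inner′
        })))
    where
    open Subdivision D
    no-five : ∀ {p rest} → deg v Cs ≡ 2 → Cs ≈ chain v p v ∷ rest → length p ≡ 4 → Good G (v ∷ p)
    no-five {p} {rest} _ eq l with ∈⇒↭ vm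
    ... | Vs″ , veq = ⊥-elim (¬C5 (five-cycle conn (walk (Inv-≈ G eq inv) (here refl)) l unique all2))
      where
      rearranged : Vs ++ ints Cs ↭ (v ∷ p) ++ (Vs″ ++ ints rest)
      rearranged = ↭-trans (++⁺ veq (≈-ints eq)) (prep v (shifts Vs″ p))
      unique : Unique (v ∷ p)
      unique = Unique-++ˡ (v ∷ p) (Unique-↭ rearranged distinct)
      all2 : ∀ {u} → u ∈ v ∷ p → degree G u ≡ 2
      all2 (here refl) = trans (sym (degrees vm)) d2
      all2 (there m)   = inner (∈-resp-↭ (↭-sym (≈-ints eq)) (∈-++⁺ˡ m))
    S : Settled G v Vs Cs
    S = settle G inv vm (≤-reflexive (sym d2)) no-five
    module S = Settled S
    ≢v : ∀ {w} → w ∈ S.Vs′ → w ≢ v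
    ≢v m refl = S.gone d2 m
    distinct′ : Unique (S.Vs′ ++ ints S.Cs′)
    distinct′ = Unique-++ʳ S.removed (Unique-↭ S.verts distinct)
    inner′ : ∀ {u} → u ∈ ints S.Cs′ → degree G u ≡ 2
    inner′ {u} m with ∈-++⁻ Vs (∈-resp-↭ (↭-sym S.verts) (∈-++⁺ʳ S.removed (∈-++⁺ʳ S.Vs′ m)))
    ... | inj₂ m′ = inner m′
    -- Only `v` itself can turn from a branch vertex into an inner one, and its degree is 2.
    ... | inj₁ um with u ≟ v
    ...   | yes refl = trans (sym (degrees um)) d2
    ...   | no u≢v   = ⊥-elim (Unique-++-disjoint S.Vs′ distinct′ (S.kept um u≢v) m)

  -- Directs each edge from its smaller to its larger end, so that `edges` lists it once.
  forward : Fin n → Fin n → Bool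
  forward i j = does (i <? j) ∧ adj G i j

  edge : Fin n → Fin n → List (Chain n)
  edge i j = if forward i j then chain i [] j ∷ [] else []

  edges : List (Chain n)
  edges = concatMap (λ i → concatMap (edge i) (allFin n)) (allFin n)

  ∈-edges : ∀ {e} → e ∈ edges → Adj G (src e) (tgt e) × mid e ≡ []
  ∈-edges m with find (∈-concatMap⁻ (λ i → concatMap (edge i) (allFin n)) {xs = allFin n} m)
  ... | i , _ , m′ with find (∈-concatMap⁻ (edge i) {xs = allFin n} m′)
  ...   | j , _ , m″ = at m″ refl
    where
    second : ∀ b c → b ∧ c ≡ true → c ≡ true
    second true c e = e
    at : ∀ {e b} → e ∈ (if b then chain i [] j ∷ [] else []) → forward i j ≡ b → Adj G (src e) (tgt e) × mid e ≡ []
    at {b = true} (here refl) f = second (does (i <? j)) (adj G i j) f , refl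

  ⅀-edges : ∀ f → ⅀ f edges ≡ ⅀ (λ i → ⅀ (λ j → b2n (forward i j) * f (chain i [] j)) (allFin n)) (allFin n)
  ⅀-edges f = trans (⅀-concatMap _ f (allFin n)) (⅀-cong (allFin n) (λ {i} _ →
    trans (⅀-concatMap (edge i) f (allFin n)) (⅀-cong (allFin n) (λ {j} _ → at i j))))
    where
    at : ∀ i j → ⅀ f (edge i j) ≡ b2n (forward i j) * f (chain i [] j)
    at i j with forward i j
    ... | true  = refl
    ... | false = refl

  pick : ∀ x y (H : Fin n → Fin n → ℕ) →
         ⅀ (λ i → ⅀ (λ j → δ i x * (δ j y * H i j)) (allFin n)) (allFin n) ≡ H x y
  pick x y H = trans (⅀-cong (allFin n) (λ {i} _ → trans (⅀-* (δ i x) (λ j → δ j y * H i j) (allFin n))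
    (cong (δ i x *_) (⅀-δ-all y (H i))))) (⅀-δ-all x (λ i → H i y))

  forward-both : ∀ v j → b2n (forward v j) + b2n (forward j v) ≡ b2n (adj G v j)
  forward-both v j with Fin.<-cmp v j
  ... | tri< lt _ ¬gt rewrite dec-true (v <? j) lt | dec-false (j <? v) ¬gt = +-identityʳ _
  ... | tri> ¬lt _ gt rewrite dec-false (v <? j) ¬lt | dec-true (j <? v) gt = cong b2n (Graph.sym G j v)
  ... | tri≈ ¬lt refl _ rewrite dec-false (v <? v) ¬lt | irrefl G v = refl

  deg-edges : ∀ v → deg v edges ≡ degree G v
  deg-edges v = begin
    deg v edges
      ≡⟨ ⅀-edges (inc v) ⟩
    ⅀ (λ i → ⅀ (λ j → b2n (forward i j) * (δ v i + δ v j)) (allFin n)) (allFin n)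
      ≡⟨ ⅀-cong (allFin n) (λ {i} _ → trans
           (⅀-cong (allFin n) (λ {j} _ → trans (*-distribˡ-+ (b2n (forward i j)) (δ v i) (δ v j)) (cong₂ _+_
              (trans (*-comm _ (δ v i)) (cong (_* b2n (forward i j)) (δ-sym v i)))
              (trans (*-comm _ (δ v j)) (cong (_* b2n (forward i j)) (δ-sym v j))))))
           (trans (⅀-+ (λ j → δ i v * b2n (forward i j)) (λ j → δ j v * b2n (forward i j)) (allFin n))
             (cong₂ _+_ (⅀-* (δ i v) (λ j → b2n (forward i j)) (allFin n)) (⅀-δ-all v (λ j → b2n (forward i j)))))) ⟩
    ⅀ (λ i → δ i v * ⅀ (λ j → b2n (forward i j)) (allFin n) + b2n (forward i v)) (allFin n)
      ≡⟨ ⅀-+ (λ i → δ i v * ⅀ (λ j → b2n (forward i j)) (allFin n)) (λ i → b2n (forward i v)) (allFin n) ⟩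
    ⅀ (λ i → δ i v * ⅀ (λ j → b2n (forward i j)) (allFin n)) (allFin n) + ⅀ (λ i → b2n (forward i v)) (allFin n)
      ≡⟨ cong (_+ ⅀ (λ i → b2n (forward i v)) (allFin n)) (⅀-δ-all v (λ i → ⅀ (λ j → b2n (forward i j)) (allFin n))) ⟩
    ⅀ (λ j → b2n (forward v j)) (allFin n) + ⅀ (λ i → b2n (forward i v)) (allFin n)
      ≡⟨ ⅀-+ (λ j → b2n (forward v j)) (λ j → b2n (forward j v)) (allFin n) ⟨
    ⅀ (λ j → b2n (forward v j) + b2n (forward j v)) (allFin n)
      ≡⟨ ⅀-cong (allFin n) (λ {j} _ → forward-both v j) ⟩
    degree G v ∎
    where open ≡-Reasoning

  links-edges : ∀ x y → ⅀ (links x y) edges ≤ 1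
  links-edges x y = ≤-trans (≤-reflexive (begin
    ⅀ (links x y) edges
      ≡⟨ ⅀-edges (links x y) ⟩
    ⅀ (λ i → ⅀ (λ j → b2n (forward i j) * (1 * (δ x i * δ y j + δ x j * δ y i))) (allFin n)) (allFin n)
      ≡⟨ ⅀-cong (allFin n) (λ {i} _ → trans
           (⅀-cong (allFin n) (λ {j} _ → trans
             (cong (λ k → b2n (forward i j) * (1 * k))
               (cong₂ _+_ (cong₂ _*_ (δ-sym x i) (δ-sym y j)) (cong₂ _*_ (δ-sym x j) (δ-sym y i))))
             (lemma (b2n (forward i j)) (δ i x) (δ j y) (δ j x) (δ i y))))
           (⅀-+ (λ j → δ i x * (δ j y * b2n (forward i j))) (λ j → δ i y * (δ j x * b2n (forward i j))) (allFin n))) ⟩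
    ⅀ (λ i → ⅀ (λ j → δ i x * (δ j y * b2n (forward i j))) (allFin n)
           + ⅀ (λ j → δ i y * (δ j x * b2n (forward i j))) (allFin n)) (allFin n)
      ≡⟨ ⅀-+ (λ i → ⅀ (λ j → δ i x * (δ j y * b2n (forward i j))) (allFin n))
             (λ i → ⅀ (λ j → δ i y * (δ j x * b2n (forward i j))) (allFin n)) (allFin n) ⟩
    ⅀ (λ i → ⅀ (λ j → δ i x * (δ j y * b2n (forward i j))) (allFin n)) (allFin n)
      + ⅀ (λ i → ⅀ (λ j → δ i y * (δ j x * b2n (forward i j))) (allFin n)) (allFin n)
      ≡⟨ cong₂ _+_ (pick x y (λ i j → b2n (forward i j))) (pick y x (λ i j → b2n (forward i j))) ⟩
    b2n (forward x y) + b2n (forward y x)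
      ≡⟨ forward-both x y ⟩
    b2n (adj G x y) ∎)) (b2n≤1 (adj G x y))
    where
    open ≡-Reasoning
    lemma : ∀ f a b c d → f * (1 * (a * b + c * d)) ≡ a * (b * f) + d * (c * f)
    lemma = solve-∀
    b2n≤1 : ∀ b → b2n b ≤ 1
    b2n≤1 true  = ≤-refl
    b2n≤1 false = z≤n

  ints-edges : ints edges ≡ []
  ints-edges = all-empty edges (λ m → proj₂ (∈-edges m))
    where
    all-empty : ∀ es → (∀ {e} → e ∈ es → mid e ≡ []) → ints es ≡ []
    all-empty []       _ = refl
    all-empty (e ∷ es) h = cong₂ _++_ (h (here refl)) (all-empty es (h ∘ there))

  initial : Subdivision (allFin n) edges
  initial = record
    { inv = record
      { uniq   = allFin⁺ n
      ; ends   = λ _ → ∈-allFin _ , ∈-allFin _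
      ; walk   = edge-walk
      ; loop   = λ m l → ⊥-elim (Adj-≢ G (proj₁ (∈-edges m)) l)
      ; simple = links-edges
      }
    ; distinct = subst (λ zs → Unique (allFin n ++ zs)) (sym ints-edges)
        (Unique-↭ (↭-sym (++-identityʳ (allFin n))) (allFin⁺ n))
    ; degrees  = λ {v} _ → deg-edges v
    ; inner    = λ m → absent (subst (_ ∈_) ints-edges m)
    }
    where
    absent : ∀ {v} {A : Set} → v ∈ ([] {A = Fin n}) → A
    absent ()
    edge-walk : ∀ {e} → e ∈ edges → Walk G (src e) (mid e) (tgt e)
    edge-walk {e} m with ∈-edges m
    ... | xy , null = subst (λ p → Walk G (src e) p (tgt e)) (sym null) (last xy)

  all-good : Connected G → MinDegreeAtLeast G 2 → ¬ Isomorphic G C5 → Good G (allFin n)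
  all-good conn δ≥2 ¬C5 = Good-↭ G (++-identityʳ (allFin n)) (subst (λ zs → Good G (allFin n ++ zs)) ints-edges
    (suppress (length edges) conn δ≥2 ¬C5 ≤-refl initial))

-- Functions of minimum weight and the conclusion

-- Functions are coded by elements of `Fin (m ^ n)`, which makes the search for a lighter one
-- finite. Decoding recovers a function only pointwise, hence `resp`.
minimum : ∀ {n m} {Λ : Set} (enc : Λ → Fin m) (dec : Fin m → Λ) → (∀ l → dec (enc l) ≡ l) →
          (Q : (Fin n → Λ) → Set) → (∀ f → Dec (Q f)) → (∀ {f g} → (∀ v → f v ≡ g v) → Q f → Q g) →
          (wt : Λ → ℕ) → ∃ Q → ∃ λ f → Q f × (∀ g → Q g → Σᵥ (wt ∘ f) ≤ Σᵥ (wt ∘ g))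
minimum {n} {m} {Λ} enc dec dec-enc Q Q? resp wt start = let (f , q) , least = descend Φ improve start in f , q , least
  where
  Φ : ∃ Q → ℕ
  Φ (f , _) = Σᵥ (wt ∘ f)
  Least : ∃ Q → Set
  Least s = ∀ g → Q g → Φ s ≤ Σᵥ (wt ∘ g)
  decode : Fin (m ^ n) → Fin n → Λ
  decode c = dec ∘ finToFun c
  code : (Fin n → Λ) → Fin (m ^ n)
  code g = funToFin (enc ∘ g)
  decode-code : ∀ g v → decode (code g) v ≡ g v
  decode-code g v = trans (cong dec (finToFun-funToFin (enc ∘ g) v)) (dec-enc (g v))
  improve : ∀ s → Least s ⊎ ∃ λ s′ → Φ s′ < Φ s
  improve s with Fin.any? (λ c → Q? (decode c) ×-dec (Σᵥ (wt ∘ decode c) <?ℕ Φ s))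
  ... | yes (c , q , lt) = inj₂ ((decode c , q) , lt)
  ... | no ¬better = inj₁ (λ g q → ≮⇒≥ (λ lt → ¬better (code g , resp (λ v → sym (decode-code g v)) q ,
          subst (_< Φ s) (⅀-cong (allFin n) (λ {v} _ → cong wt (sym (decode-code g v)))) lt)))

module _ {n : ℕ} (G : Graph n) where

  is2RDF? : ∀ f → Dec (Is2RDF G f)
  is2RDF? f = all? (λ u → ((proj₁ (f u) Bool.≟ false) ×-dec (proj₂ (f u) Bool.≟ false)) →-dec
    (Fin.any? (λ v → (adj G u v Bool.≟ true) ×-dec (proj₁ (f v) Bool.≟ true)) ×-dec
     Fin.any? (λ v → (adj G u v Bool.≟ true) ×-dec (proj₂ (f v) Bool.≟ true))))

  Is2RDF-resp : ∀ {f g : Fin n → Label2} → (∀ v → f v ≡ g v) → Is2RDF G f → Is2RDF G g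
  Is2RDF-resp eq d u empty with d u (subst IsEmptyLabel (sym (eq u)) empty)
  ... | (v , e , h) , (v′ , e′ , h′) =
    (v , e , trans (cong proj₁ (sym (eq v))) h) , (v′ , e′ , trans (cong proj₂ (sym (eq v′))) h′)

  isRDF? : ∀ g → Dec (IsRDF G g)
  isRDF? g = all? (λ u → (toℕ (g u) ≟ℕ 0) →-dec
    Fin.any? (λ v → (adj G u v Bool.≟ true) ×-dec (toℕ (g v) ≟ℕ 2)))

  IsRDF-resp : ∀ {f g : Fin n → Fin 3} → (∀ v → f v ≡ g v) → IsRDF G f → IsRDF G g
  IsRDF-resp eq d u zero′ with d u (trans (cong toℕ (eq u)) zero′)
  ... | v , e , h = v , e , trans (cong toℕ (sym (eq v))) h

  γr2 : ∃ (Is2RDF G) → ∃ λ f → Is2RDF G f × (∀ g → Is2RDF G g → weight2 f ≤ weight2 g)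
  γr2 = minimum enc dec dec-enc (Is2RDF G) is2RDF? Is2RDF-resp (Rule.wt rainbow)
    where
    enc : Label2 → Fin 4
    enc (false , false) = 0F
    enc (false , true)  = 1F
    enc (true  , false) = 2F
    enc (true  , true)  = 3F
    dec : Fin 4 → Label2
    dec 0F = false , false
    dec 1F = false , true
    dec 2F = true , false
    dec 3F = true , true
    dec-enc : ∀ l → dec (enc l) ≡ l
    dec-enc (false , false) = refl
    dec-enc (false , true)  = refl
    dec-enc (true  , false) = refl
    dec-enc (true  , true)  = refl

  γR : ∃ (IsRDF G) → ∃ λ g → IsRDF G g × (∀ h → IsRDF G h → weightR g ≤ weightR h)
  γR = minimum (λ l → l) (λ l → l) (λ _ → refl) (IsRDF G) isRDF? IsRDF-resp toℕ

theorem3 : (n : ℕ) (G : Graph n) → Connected G → MinDegreeAtLeast G 2 →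
    ¬ Isomorphic G C5 →
    Σ ℕ λ a → Σ ℕ λ b → IsGammaR2 G a × IsGammaR G b × (3 * (a + b) ≤ 4 * n)
theorem3 n G conn δ≥2 ¬C5 with all-good G conn δ≥2 ¬C5
... | a , b , F , H , le with Rb.labelling⇒function G F | Rm.labelling⇒function G H
... | f , f-dom , f≤a | g , g-dom , g≤b
  with γr2 G (f , λ u nd → f-dom u nd true , f-dom u nd false) | γR G (g , λ u nd → g-dom u nd tt)
... | f₀ , f₀-dom , f₀-least | g₀ , g₀-dom , g₀-least =
  weight2 f₀ , weightR g₀ , ((f₀ , f₀-dom , refl) , f₀-least) , ((g₀ , g₀-dom , refl) , g₀-least) , (begin
    3 * (weight2 f₀ + weightR g₀)
      ≤⟨ *-monoʳ-≤ 3 (+-mono-≤ (≤-trans (f₀-least f (λ u nd → f-dom u nd true , f-dom u nd false)) f≤a)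
                               (≤-trans (g₀-least g (λ u nd → g-dom u nd tt)) g≤b)) ⟩
    3 * (a + b)
      ≤⟨ le ⟩
    4 * length (allFin n)
      ≡⟨ cong (4 *_) (length-tabulate {n = n} (λ v → v)) ⟩
    4 * n ∎)
  where open ≤-Reasoning
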